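{- Let $n$ and $\gamma$ be positive integers and put $\mu=\frac{(n-1)\gamma}{2}$. If there exists a large set with multiplicity LS$(3,4,n;\mu)$ and a perpendicular array PA$_{\gamma}(2,n,n)$, then there exists a large set with multiplicity LS$(3,4,2^m n;\mu)$ for each integer $m\geq 0$.
   Context: A Steiner system S$(t,k,n)$ is a pair $(Q,B)$ where $Q$ is an $n$-set and $B$ is a collection of $k$-subsets (blocks) of $Q$ such that every $t$-subset of $Q$ is contained in exactly one block. A large set with multiplicity $\mu$, LS$(t,k,n;\mu)$, is a family (the same system may occur more than once) of Steiner systems S$(t,k,n)$ on a common $n$-set $Q$ such that every $k$-subset of $Q$ is a block of exactly $\mu$ of the systems. A perpendicular array PA$_\lambda(k,\ell,n)$ is a $\lambda\binom{n}{k}\times \ell$ matrix with entries from an $n$-set such that each row has $\ell$ distinct entries and, in the submatrix formed by any $k$ columns, each $k$-subset of the $n$-set occurs (as the set of entries of a row) exactly $\lambda$ times.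
   Formalization: A large set LS(3,4,n;μ) is required to have n ≥ 4; otherwise the empty family is vacuously a large set and the claim fails, e.g. for n = 3, γ = μ = 1, since no S(3,4,6) exists. -}

module Defs where

open import Data.Bool.Properties using () renaming (_≟_ to _≟ᵇ_)
open import Data.Fin.Base using (Fin)
open import Data.Fin.Properties using (_≟_; any?)
open import Data.Fin.Subset using (Subset; _⊆_; ∣_∣)
open import Data.Fin.Subset.Properties using (_∈?_)
open import Data.List.Base using (List; length; filter)
open import Data.Nat.Base using (ℕ; _*_; _≤_)
open import Data.Nat.Combinatorics using (_C_)
open import Data.Product using (∃!; _×_)
open import Data.Vec.Base using (Vec; lookup; tabulate; count)
open import Data.Vec.Properties using (≡-dec)
open import Data.Vec.Relation.Unary.All using (All)
open import Data.Vec.Relation.Unary.Unique.Propositional using (Unique)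
open import Level using (0ℓ)
open import Relation.Binary.Definitions using (DecidableEquality)
open import Relation.Binary.PropositionalEquality.Core using (_≡_)
open import Relation.Nullary.Decidable using (does; _×-dec_)
open import Relation.Unary using (Pred; Decidable)

infix 4 _≟ˢ_

_≟ˢ_ : ∀ {n} → DecidableEquality (Subset n)
_≟ˢ_ = ≡-dec _≟ᵇ_

image : ∀ {ℓ n} → (Fin ℓ → Fin n) → Subset ℓ → Subset n
image f S = tabulate λ y → does (any? λ x → (x ∈? S) ×-dec (f x ≟ y))

-- The point set is Fin n.  A collection of blocks is a decidable predicate
-- on subsets, so it is a set (no repeated blocks).
record SteinerSystem (t k n : ℕ) : Set₁ where
  field
    Block   : Pred (Subset n) 0ℓ
    block?  : Decidable Block
    uniform : ∀ B → Block B → ∣ B ∣ ≡ k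
    covers  : ∀ T → ∣ T ∣ ≡ t → ∃! _≡_ λ B → Block B × T ⊆ B

open SteinerSystem public using (Block; block?)

-- The field k≤n is the usual parameter range for S(t,k,n).  When n < k there
-- are no k-subsets, so without it the empty family would be a large set of
-- every multiplicity.
record LargeSet (t k n μ : ℕ) : Set₁ where
  field
    k≤n          : k ≤ n
    systems      : List (SteinerSystem t k n)
    multiplicity : ∀ K → ∣ K ∣ ≡ k →
                   length (filter (λ S → block? S K) systems) ≡ μ

record PerpendicularArray (lam k ℓ n : ℕ) : Set where
  field
    rows          : Vec (Vec (Fin n) ℓ) (lam * (n C k))
    distinct      : All Unique rows
    perpendicular : ∀ (columns : Subset ℓ) → ∣ columns ∣ ≡ k →
                    ∀ (K : Subset n) → ∣ K ∣ ≡ k →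
                    count (λ r → image (lookup r) columns ≟ˢ K) rows ≡ lam

{-# OPTIONS --safe #-}

-- Let X be the N points, carrying an abelian group and a one-factorisation of
-- the complete graph with the N ∸ 1 nonzero elements as colours.  A system S on
-- X and a permutation P of the colours give the doubled system on X × Bool: S
-- on both halves, and the blocks {a, b | c, d} with P (colour a b) = colour c d.
-- Doubling a large set covers the blocks inside a half μ times; those meeting
-- the halves in 3 + 1 points come from μ N "crossing" systems without blocks
-- inside a half, and the permutations P have to make up for the 2 + 2 blocks
-- that the crossing systems leave uncovered.
--
-- On the n given points each row of the perpendicular array yields a crossing
-- system; together they cover every 2 + 2 block γ times, and the cyclic shifts
-- of the colours, each used μ ∸ γ times, supply the rest.
--
-- The array is not needed again: a crossing system on two copies (the sides) of
-- X × Bool (the levels) is the double of one on two copies of X, taken either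
-- along the level or along level + side.  The colour permutation used there
-- exchanges the colours inside the sides with all but one colour t across, and
-- takes e - t to t.  The blocks with one point at each level of each side are
-- then those with a + b + c + d = e₀ for the first direction and e₁ for the
-- second.  The reflections s ↦ e - s of the colours across the levels, for e
-- other than e₀, e₁, e₂, and one more exchange with e₂, complete the count.

module Submission where

open import Defs
open import Data.Nat.Base using (ℕ; zero; suc; _+_; _*_; _∸_; _^_; _≤_; _<_; z≤n; s≤s; NonZero; >-nonZero⁻¹)
open import Relation.Binary.PropositionalEquality.Core using (_≡_)
open import Algebra.Bundles using (CommutativeSemigroup)
open import Algebra.Structures using (IsAbelianGroup)
open import Data.Bool.Base using (Bool; true; false; not; _∧_; _xor_; if_then_else_)
open import Data.Bool.Properties using (not-involutive; xor-assoc; xor-comm; xor-same; xor-identityʳ) renaming (_≟_ to _≟ᵇ_)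
open import Data.Empty using (⊥; ⊥-elim)
open import Data.Fin.Base using (Fin; zero; suc; toℕ; punchIn; punchOut)
import Data.Fin.Properties as Fin
open import Data.Fin.Subset using (Subset; inside; outside; _∈_; _∉_; _⊆_; ∣_∣; ⁅_⁆; _∪_) renaming (⊥ to ∅)
open import Data.Fin.Subset.Properties using (_∈?_; ∉⊥; x∈⁅x⁆; x∈⁅y⁆⇒x≡y; x∈p∪q⁺; x∈p∪q⁻; ∪-identityˡ; ∪-comm; ∪-assoc; ∣⊥∣≡0; p⊆q⇒∣p∣≤∣q∣; drop-∷-⊆; drop-there; ⊆-antisym)
open import Data.List.Base using (List; []; _∷_; _++_; map; length; concat; replicate; zip; filter; allFin; tabulate)
open import Data.List.Properties using (length-map; length-++; length-tabulate; map-++; map-tabulate)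
open import Data.Nat.DivMod using (_%_; _mod_; m%n<n; %-distribˡ-+; m%n%n≡m%n; m<n⇒m%n≡m; n%n≡0)
open import Data.Nat.ListAction using (sum)
open import Data.Nat.ListAction.Properties using (sum-++)
import Data.Nat.Properties as ℕ
open import Data.Product using (∃; ∃!; _×_; _,_; proj₁; proj₂)
open import Data.Product.Function.NonDependent.Propositional using (_×-↔_)
import Data.Product.Properties as Product
open import Data.Sum.Base using (_⊎_; inj₁; inj₂)
open import Data.Vec.Base as Vec using (Vec; []; _∷_)
open import Data.Vec.Properties using ([]=⇒lookup; lookup⇒[]=; lookup∘tabulate)
open import Data.Vec.Relation.Unary.All using (All; []; _∷_)
open import Data.Vec.Relation.Unary.Unique.Propositional using (Unique)
open import Data.Vec.Relation.Unary.Unique.Propositional.Properties using (lookup-injective)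
open import Function.Base using (_∘_; case_of_)
open import Function.Bundles using (_↔_; mk⇔; mk↔ₛ′; Inverse)
open import Function.Properties.Inverse using (↔-refl; ↔-trans)
open import Level using (0ℓ)
open import Relation.Binary.Definitions using (DecidableEquality)
open import Relation.Binary.PropositionalEquality
open import Relation.Nullary using (¬_; Dec; yes; no; contradiction)
open import Relation.Nullary.Decidable using (does; does-⇔; dec-true; dec-false; _×-dec_; _⊎-dec_; ¬?)

private
  variable
    A B : Set
    n   : ℕ

-- Indicators and sums over lists

♯ : {P : Set} → Dec P → ℕ
♯ p? = if does p? then 1 else 0

♯-cong : {P Q : Set} (p? : Dec P) (q? : Dec Q) → (P → Q) → (Q → P) → ♯ p? ≡ ♯ q?
♯-cong p? q? f g = cong (if_then 1 else 0) (does-⇔ (mk⇔ f g) p? q?)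

♯-no : {P : Set} (p? : Dec P) → ¬ P → ♯ p? ≡ 0
♯-no p? ¬p = cong (if_then 1 else 0) (dec-false p? ¬p)

-- Families are lists with repetition, so a multiplicity is the tally of an indicator; counts over
-- several families then become sums that can be split and interchanged.
tally : ∀ {a} {A : Set a} → (A → ℕ) → List A → ℕ
tally h = sum ∘ map h

tally-cong : ∀ {a} {A : Set a} {h k : A → ℕ} → (∀ x → h x ≡ k x) → ∀ xs → tally h xs ≡ tally k xs
tally-cong h≗k []       = refl
tally-cong h≗k (x ∷ xs) = cong₂ _+_ (h≗k x) (tally-cong h≗k xs)

tally-zero : {h : A → ℕ} → (∀ x → h x ≡ 0) → ∀ xs → tally h xs ≡ 0
tally-zero h≗0 []       = refl
tally-zero h≗0 (x ∷ xs) = cong₂ _+_ (h≗0 x) (tally-zero h≗0 xs)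

tally-++ : (h : A → ℕ) → ∀ xs ys → tally h (xs ++ ys) ≡ tally h xs + tally h ys
tally-++ h xs ys = trans (cong sum (map-++ h xs ys)) (sum-++ (map h xs) (map h ys))

tally-map : ∀ {a b} {A : Set a} {B : Set b} (h : B → ℕ) (k : A → B) → ∀ xs → tally h (map k xs) ≡ tally (h ∘ k) xs
tally-map h k []       = refl
tally-map h k (x ∷ xs) = cong (h (k x) +_) (tally-map h k xs)

tally-+ : (h k : A → ℕ) → ∀ xs → tally (λ x → h x + k x) xs ≡ tally h xs + tally k xs
tally-+ h k []       = refl
tally-+ h k (x ∷ xs) = trans (cong (h x + k x +_) (tally-+ h k xs))
                             (+-interchange (h x) (k x) (tally h xs) (tally k xs))
  where open import Algebra.Properties.CommutativeSemigroup ℕ.+-commutativeSemigroup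
          renaming (interchange to +-interchange)

-- Two families of equal length get paired member by member; a block type on which only one
-- component bears is then counted in that family alone.
tally-zip₁ : (h : A → ℕ) → ∀ xs (ys : List B) → length xs ≡ length ys →
             tally (h ∘ proj₁) (zip xs ys) ≡ tally h xs
tally-zip₁ h []       ys       eq = refl
tally-zip₁ h (x ∷ xs) (y ∷ ys) eq = cong (h x +_) (tally-zip₁ h xs ys (ℕ.suc-injective eq))

tally-zip₂ : (h : B → ℕ) → ∀ (xs : List A) ys → length xs ≡ length ys →
             tally (h ∘ proj₂) (zip xs ys) ≡ tally h ys
tally-zip₂ h []       []       eq = refl
tally-zip₂ h (x ∷ xs) (y ∷ ys) eq = cong (h y +_) (tally-zip₂ h xs ys (ℕ.suc-injective eq))

copies : ℕ → List A → List A
copies m xs = concat (replicate m xs)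

tally-copies : (h : A → ℕ) → ∀ m xs → tally h (copies m xs) ≡ m * tally h xs
tally-copies h zero    xs = refl
tally-copies h (suc m) xs = trans (tally-++ h xs (copies m xs))
                                  (cong (tally h xs +_) (tally-copies h m xs))

length-copies : ∀ m (xs : List A) → length (copies m xs) ≡ m * length xs
length-copies zero    xs = refl
length-copies (suc m) xs = trans (length-++ xs) (cong (length xs +_) (length-copies m xs))

length-zip : (xs : List A) (ys : List B) → length xs ≡ length ys →
             length (zip xs ys) ≡ length xs
length-zip []       ys       eq = refl
length-zip (x ∷ xs) (y ∷ ys) eq = cong suc (length-zip xs ys (ℕ.suc-injective eq))

-- Quadruple systems and their doubles

-- A Steiner quadruple system as a totally symmetric ternary operation: the
-- blocks are the sets {a, b, c, op a b c} with a, b, c distinct.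
record Skein (A : Set) : Set where
  field
    op     : A → A → A → A
    comm₁₂ : ∀ a b c → op a b c ≡ op b a c
    comm₂₃ : ∀ a b c → op a b c ≡ op a c b
    cancel : ∀ a b → op a a b ≡ b
    invol  : ∀ a b c → op a b (op a b c) ≡ c

  comm₁₃ : ∀ a b c → op a b c ≡ op c b a
  comm₁₃ a b c = trans (comm₁₂ a b c) (trans (comm₂₃ b a c) (comm₁₂ b c a))

  flip₃₄ : ∀ {a b c d} → op a b c ≡ d → op a b d ≡ c
  flip₃₄ {a} {b} {c} refl = invol a b c

  cancel₁₃ : ∀ a b → op a b a ≡ b
  cancel₁₃ a b = trans (comm₂₃ a b a) (cancel a b)

  cancel₂₃ : ∀ a b → op a b b ≡ a
  cancel₂₃ a b = trans (comm₁₃ a b b) (cancel b a)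

  -- The map `op a c` is an involution. The hypothesis says that it takes `b` to `c`, hence `c` to
  -- `b`; but it always takes `c` to `a`.
  fixed⇒≡ : ∀ {a b c} → op a b c ≡ c → a ≡ b
  fixed⇒≡ {a} {b} {c} eq =
    trans (sym (cancel₂₃ a c)) (flip₃₄ (trans (comm₂₃ a c b) eq))

open Skein

Distinct₃ : {A : Set} (a b c : A) → Set
Distinct₃ a b c = a ≢ b × a ≢ c × b ≢ c

module _ (S : Skein A) {a b c : A} (a≢b : a ≢ b) (a≢c : a ≢ c) (b≢c : b ≢ c) where

  op≢₁ : op S a b c ≢ a
  op≢₁ eq = b≢c (fixed⇒≡ S (trans (sym (trans (comm₁₂ S a b c) (comm₂₃ S b a c))) eq))

  op≢₂ : op S a b c ≢ b
  op≢₂ eq = a≢c (fixed⇒≡ S (trans (comm₂₃ S a c b) eq))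

  op≢₃ : op S a b c ≢ c
  op≢₃ eq = a≢b (fixed⇒≡ S eq)

transport : A ↔ B → Skein B → Skein A
transport i S = record
  { op     = λ a b c → from (op S (to a) (to b) (to c))
  ; comm₁₂ = λ a b c → cong from (comm₁₂ S (to a) (to b) (to c))
  ; comm₂₃ = λ a b c → cong from (comm₂₃ S (to a) (to b) (to c))
  ; cancel = λ a b → trans (cong from (cancel S (to a) (to b))) (strictlyInverseʳ b)
  ; invol  = λ a b c → trans
      (cong (from ∘ op S (to a) (to b)) (strictlyInverseˡ _))
      (trans (cong from (invol S (to a) (to b) (to c))) (strictlyInverseʳ c))
  }
  where open Inverse i

-- For a, b in half s and c in the other half, link s a b c is the fourth point
-- of the block through them; it lies in the half of c.
record Link (A : Set) : Set where
  field
    link        : Bool → A → A → A → A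
    link-comm   : ∀ s a b c → link s a b c ≡ link s b a c
    link-cancel : ∀ s a c → link s a a c ≡ c
    link-invol  : ∀ s a b c → link s a b (link s a b c) ≡ c
    link-cross  : ∀ s a b c → link (not s) c (link s a b c) a ≡ b

open Link

-- When the arguments meet both halves, the two points in the same half go first in `link`, so most
-- symmetries hold by computation. If the first two arguments lie in different halves, involutivity
-- is exactly `link-cross`.
double : Skein A → Link A → Skein (A × Bool)
double {A} S L = record
  { op = dop ; comm₁₂ = comm-12 ; comm₂₃ = comm-23 ; cancel = dcancel ; invol = dinvol }
  where
  dop : A × Bool → A × Bool → A × Bool → A × Bool
  dop (a , false) (b , false) (c , false) = op S a b c , false
  dop (a , true)  (b , true)  (c , true)  = op S a b c , true
  dop (a , false) (b , false) (c , true)  = link L false a b c , true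
  dop (a , true)  (b , true)  (c , false) = link L true a b c , false
  dop (a , false) (b , true)  (c , false) = link L false a c b , true
  dop (a , true)  (b , false) (c , true)  = link L true a c b , false
  dop (a , true)  (b , false) (c , false) = link L false b c a , true
  dop (a , false) (b , true)  (c , true)  = link L true b c a , false

  comm-12 : ∀ x y z → dop x y z ≡ dop y x z
  comm-12 (a , false) (b , false) (c , false) = cong (_, false) (comm₁₂ S a b c)
  comm-12 (a , true)  (b , true)  (c , true)  = cong (_, true) (comm₁₂ S a b c)
  comm-12 (a , false) (b , false) (c , true)  = cong (_, true) (link-comm L false a b c)
  comm-12 (a , true)  (b , true)  (c , false) = cong (_, false) (link-comm L true a b c)
  comm-12 (a , false) (b , true)  (c , false) = refl
  comm-12 (a , true)  (b , false) (c , true)  = refl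
  comm-12 (a , true)  (b , false) (c , false) = refl
  comm-12 (a , false) (b , true)  (c , true)  = refl

  comm-23 : ∀ x y z → dop x y z ≡ dop x z y
  comm-23 (a , false) (b , false) (c , false) = cong (_, false) (comm₂₃ S a b c)
  comm-23 (a , true)  (b , true)  (c , true)  = cong (_, true) (comm₂₃ S a b c)
  comm-23 (a , false) (b , false) (c , true)  = refl
  comm-23 (a , true)  (b , true)  (c , false) = refl
  comm-23 (a , false) (b , true)  (c , false) = refl
  comm-23 (a , true)  (b , false) (c , true)  = refl
  comm-23 (a , true)  (b , false) (c , false) = cong (_, true) (link-comm L false b c a)
  comm-23 (a , false) (b , true)  (c , true)  = cong (_, false) (link-comm L true b c a)

  dcancel : ∀ x y → dop x x y ≡ y
  dcancel (a , false) (b , false) = cong (_, false) (cancel S a b)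
  dcancel (a , true)  (b , true)  = cong (_, true) (cancel S a b)
  dcancel (a , false) (b , true)  = cong (_, true) (link-cancel L false a b)
  dcancel (a , true)  (b , false) = cong (_, false) (link-cancel L true a b)

  dinvol : ∀ x y z → dop x y (dop x y z) ≡ z
  dinvol (a , false) (b , false) (c , false) = cong (_, false) (invol S a b c)
  dinvol (a , true)  (b , true)  (c , true)  = cong (_, true) (invol S a b c)
  dinvol (a , false) (b , false) (c , true)  = cong (_, true) (link-invol L false a b c)
  dinvol (a , true)  (b , true)  (c , false) = cong (_, false) (link-invol L true a b c)
  dinvol (a , false) (b , true)  (c , false) = cong (_, false) (link-cross L false a c b)
  dinvol (a , true)  (b , false) (c , true)  = cong (_, true) (link-cross L true a c b)
  dinvol (a , true)  (b , false) (c , false) = cong (_, false) (link-cross L false b c a)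
  dinvol (a , false) (b , true)  (c , true)  = cong (_, true) (link-cross L true b c a)

-- A one-factorisation of the complete graph on A, the colours being the
-- elements of A other than ε.
record Colouring (A : Set) (ε : A) : Set where
  field
    colour         : A → A → A
    partner        : A → A → A
    colour-comm    : ∀ a b → colour a b ≡ colour b a
    colour-diag    : ∀ a → colour a a ≡ ε
    colour-partner : ∀ a k → colour a (partner a k) ≡ k
    partner-colour : ∀ a b → partner a (colour a b) ≡ b

  partner-ε : ∀ a → partner a ε ≡ a
  partner-ε a = trans (cong (partner a) (sym (colour-diag a))) (partner-colour a a)

  -- The edge from `a` to `partner a k` has the colour `k` seen from either end.
  partner-partner : ∀ a k → partner (partner a k) k ≡ a
  partner-partner a k = begin
    partner (partner a k) k                       ≡⟨ cong (partner (partner a k)) (colour-partner a k) ⟨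
    partner (partner a k) (colour a (partner a k)) ≡⟨ cong (partner (partner a k)) (colour-comm a _) ⟩
    partner (partner a k) (colour (partner a k) a) ≡⟨ partner-colour _ a ⟩
    a                                             ∎
    where open ≡-Reasoning

  colour≢ε : ∀ {a b} → a ≢ b → colour a b ≢ ε
  colour≢ε {a} {b} a≢b eq =
    a≢b (trans (sym (partner-ε a)) (trans (cong (partner a) (sym eq)) (partner-colour a b)))

open Colouring

-- A permutation of the colours with its inverse, indexed by the half of the known pair: `act false`
-- leads from colours in the first half to colours in the second, `act true` leads back. It fixes
-- `ε`, the colour of a repeated point, so that a repeated point on one side forces one on the
-- other.
record Recolouring (A : Set) (ε : A) : Set where
  field
    act     : Bool → A → A
    act-inv : ∀ s k → act (not s) (act s k) ≡ k
    act-ε   : ∀ s → act s ε ≡ ε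

open Recolouring

module _ {ε : A} (C : Colouring A ε) (P : Recolouring A ε) where

  colourLink : Link A
  colourLink = record
    { link        = λ s a b c → partner C c (act P s (colour C a b))
    ; link-comm   = λ s a b c → cong (partner C c ∘ act P s) (colour-comm C a b)
    ; link-cancel = λ s a c → begin
        partner C c (act P s (colour C a a)) ≡⟨ cong (partner C c ∘ act P s) (colour-diag C a) ⟩
        partner C c (act P s ε)              ≡⟨ cong (partner C c) (act-ε P s) ⟩
        partner C c ε                        ≡⟨ partner-ε C c ⟩
        c                                    ∎
    ; link-invol  = λ s a b c → partner-partner C c _
    ; link-cross  = λ s a b c → begin
        partner C a (act P (not s) (colour C c (partner C c (act P s (colour C a b)))))
          ≡⟨ cong (partner C a ∘ act P (not s)) (colour-partner C c _) ⟩
        partner C a (act P (not s) (act P s (colour C a b)))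
          ≡⟨ cong (partner C a) (act-inv P s _) ⟩
        partner C a (colour C a b)
          ≡⟨ partner-colour C a b ⟩
        b ∎
    }
    where open ≡-Reasoning

  link⇒act : ∀ s {a b c d} → link colourLink s a b c ≡ d → act P s (colour C a b) ≡ colour C c d
  link⇒act s refl = sym (colour-partner C _ _)

  act⇒link : ∀ s {a b c d} → act P s (colour C a b) ≡ colour C c d → link colourLink s a b c ≡ d
  act⇒link s {c = c} {d} eq = trans (cong (partner C c) eq) (partner-colour C c d)

act-flip : {ε : A} (P : Recolouring A ε) → ∀ s {k l} → act P s k ≡ l → act P (not s) l ≡ k
act-flip P s refl = act-inv P s _

-- Abelian groups on the points, and colours on the doubled points

record Points : Set₁ where
  infix  4 _≟_
  infixl 7 _∙_
  infix  8 _⁻¹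
  field
    Carrier        : Set
    _≟_            : DecidableEquality Carrier
    _∙_            : Carrier → Carrier → Carrier
    ε              : Carrier
    _⁻¹            : Carrier → Carrier
    isAbelianGroup : IsAbelianGroup _≡_ _∙_ ε _⁻¹

  open IsAbelianGroup isAbelianGroup public
    using (assoc; comm; identityˡ; identityʳ; inverseˡ; inverseʳ)

  commutativeSemigroup : CommutativeSemigroup 0ℓ 0ℓ
  commutativeSemigroup = record
    { isCommutativeSemigroup = IsAbelianGroup.isCommutativeSemigroup isAbelianGroup }

  open import Algebra.Properties.CommutativeSemigroup commutativeSemigroup public
    using (interchange)

  ∙⁻¹∙ : ∀ a b → a ∙ b ⁻¹ ∙ b ≡ a
  ∙⁻¹∙ a b = trans (assoc a _ b) (trans (cong (a ∙_) (inverseˡ b)) (identityʳ a))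

  ∙∙⁻¹ : ∀ a b → a ∙ b ∙ b ⁻¹ ≡ a
  ∙∙⁻¹ a b = trans (assoc a b _) (trans (cong (a ∙_) (inverseʳ b)) (identityʳ a))

  ∙⁻¹-swap : ∀ a b → a ∙ (b ∙ a ⁻¹) ≡ b
  ∙⁻¹-swap a b = trans (comm a _) (∙⁻¹∙ b a)

  ∙≡⇒≡∙⁻¹ : ∀ {a b c} → a ∙ b ≡ c → a ≡ c ∙ b ⁻¹
  ∙≡⇒≡∙⁻¹ refl = sym (∙∙⁻¹ _ _)

  ≡∙⁻¹⇒∙≡ : ∀ {a b c} → a ≡ c ∙ b ⁻¹ → a ∙ b ≡ c
  ≡∙⁻¹⇒∙≡ refl = ∙⁻¹∙ _ _

  ∙-cancelʳ : ∀ {a b c} → a ∙ c ≡ b ∙ c → a ≡ b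
  ∙-cancelʳ {a} {b} {c} eq = trans (∙≡⇒≡∙⁻¹ eq) (∙∙⁻¹ b c)

twice : Points → Points
twice G = record
  { Carrier        = Points.Carrier G × Bool
  ; _≟_            = Product.≡-dec _≟_ _≟ᵇ_
  ; _∙_            = λ (a , i) (b , j) → a ∙ b , i xor j
  ; ε              = ε , false
  ; _⁻¹            = λ (a , i) → a ⁻¹ , i
  ; isAbelianGroup = record
    { isGroup = record
      { isMonoid = record
        { isSemigroup = record
          { isMagma = record { isEquivalence = isEquivalence ; ∙-cong = λ { refl refl → refl } }
          ; assoc   = λ (a , i) (b , j) (c , k) → cong₂ _,_ (assoc a b c) (xor-assoc i j k)
          }
        ; identity = (λ (a , i) → cong (_, i) (identityˡ a))
                   , (λ (a , i) → cong₂ _,_ (identityʳ a) (xor-identityʳ i))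
        }
      ; inverse = (λ (a , i) → cong₂ _,_ (inverseˡ a) (xor-same i))
                , (λ (a , i) → cong₂ _,_ (inverseʳ a) (xor-same i))
      ; ⁻¹-cong = λ { refl → refl }
      }
    ; comm = λ (a , i) (b , j) → cong₂ _,_ (comm a b) (xor-comm i j)
    }
  }
  where
  open Points G

module _ (G : Points) where
  open Points G

  -- The old colours serve inside both halves. Edges across are coloured by sums; each sum is a
  -- perfect matching of the halves, because `a ∙ b ≡ s` has the single solution `s ∙ a ⁻¹` for `b`.
  twiceColouring : Colouring Carrier ε → Colouring (Carrier × Bool) (ε , false)
  twiceColouring C = record
    { colour = colour₂ ; partner = partner₂ ; colour-comm = c-comm ; colour-diag = c-diag
    ; colour-partner = c-p ; partner-colour = p-c }
    where
    colour₂ : Carrier × Bool → Carrier × Bool → Carrier × Bool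
    colour₂ (a , false) (b , false) = colour C a b , false
    colour₂ (a , true)  (b , true)  = colour C a b , false
    colour₂ (a , false) (b , true)  = a ∙ b , true
    colour₂ (a , true)  (b , false) = a ∙ b , true

    partner₂ : Carrier × Bool → Carrier × Bool → Carrier × Bool
    partner₂ (a , i) (k , false) = partner C a k , i
    partner₂ (a , i) (s , true)  = s ∙ a ⁻¹ , not i

    c-comm : ∀ x y → colour₂ x y ≡ colour₂ y x
    c-comm (a , false) (b , false) = cong (_, false) (colour-comm C a b)
    c-comm (a , true)  (b , true)  = cong (_, false) (colour-comm C a b)
    c-comm (a , false) (b , true)  = cong (_, true) (comm a b)
    c-comm (a , true)  (b , false) = cong (_, true) (comm a b)

    c-diag : ∀ x → colour₂ x x ≡ (ε , false)
    c-diag (a , false) = cong (_, false) (colour-diag C a)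
    c-diag (a , true)  = cong (_, false) (colour-diag C a)

    c-p : ∀ x k → colour₂ x (partner₂ x k) ≡ k
    c-p (a , false) (k , false) = cong (_, false) (colour-partner C a k)
    c-p (a , true)  (k , false) = cong (_, false) (colour-partner C a k)
    c-p (a , false) (s , true)  = cong (_, true) (∙⁻¹-swap a s)
    c-p (a , true)  (s , true)  = cong (_, true) (∙⁻¹-swap a s)

    p-c : ∀ x y → partner₂ x (colour₂ x y) ≡ y
    p-c (a , false) (b , false) = cong (_, false) (partner-colour C a b)
    p-c (a , true)  (b , true)  = cong (_, true) (partner-colour C a b)
    p-c (a , false) (b , true)  = cong (_, true) (trans (cong (_∙ a ⁻¹) (comm a b)) (∙∙⁻¹ b a))
    p-c (a , true)  (b , false) = cong (_, false) (trans (cong (_∙ a ⁻¹) (comm a b)) (∙∙⁻¹ b a))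

  -- Colours inside a half move to colours across by k ↦ k ∙ t, and back by
  -- k ∙ r ↦ k; each map misses one colour across, and r goes to t.
  exchange : (r t : Carrier) → Carrier × Bool → Carrier × Bool
  exchange r t (k , false) = if does (k ≟ ε) then (ε , false) else (k ∙ t , true)
  exchange r t (s , true)  = if does (s ≟ r) then (t , true) else (s ∙ r ⁻¹ , false)

  exchange-within : ∀ r t {k} → k ≢ ε → exchange r t (k , false) ≡ (k ∙ t , true)
  exchange-within r t {k} k≢ε rewrite dec-false (k ≟ ε) k≢ε = refl

  exchange-ε : ∀ r t → exchange r t (ε , false) ≡ (ε , false)
  exchange-ε r t rewrite dec-true (ε ≟ ε) refl = refl

  exchange-missed : ∀ r t → exchange r t (r , true) ≡ (t , true)
  exchange-missed r t rewrite dec-true (r ≟ r) refl = refl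

  exchange-across : ∀ r t {k} → k ≢ ε → exchange r t (k ∙ r , true) ≡ (k , false)
  exchange-across r t {k} k≢ε
    rewrite dec-false (k ∙ r ≟ r) (λ eq → k≢ε (∙-cancelʳ (trans eq (sym (identityˡ r)))))
    = cong (_, false) (∙∙⁻¹ k r)

  -- Every colour across other than `r` moves inside, so `r` is the only one that stays across.
  exchange-missed⁻¹ : ∀ r t {s l} → exchange r t (s , true) ≡ (l , true) → s ≡ r × t ≡ l
  exchange-missed⁻¹ r t {s} eq with s ≟ r | eq
  ... | yes s≡r | refl = s≡r , refl
  ... | no  _   | ()

  -- Interchanging `r` and `t` undoes both translations and matches the two missed colours with each
  -- other.
  exchange-inv : ∀ r t x → exchange t r (exchange r t x) ≡ x
  exchange-inv r t (k , false) with k ≟ ε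
  ... | yes refl = exchange-ε t r
  ... | no  k≢ε  = exchange-across t r k≢ε
  exchange-inv r t (s , true) with s ≟ r
  ... | yes refl = exchange-missed t r
  ... | no  s≢r  = trans (exchange-within t r λ eq → s≢r (trans (sym (∙⁻¹∙ s r)) (trans (cong (_∙ r) eq) (identityˡ r))))
                         (cong (_, true) (∙⁻¹∙ s r))

  exchanging : (r t : Carrier) → Recolouring (Carrier × Bool) (ε , false)
  exchanging r t = record { act = ex ; act-inv = ex-inv ; act-ε = ex-ε }
    where
    ex : Bool → Carrier × Bool → Carrier × Bool
    ex false = exchange r t
    ex true  = exchange t r

    ex-inv : ∀ s x → ex (not s) (ex s x) ≡ x
    ex-inv false = exchange-inv r t
    ex-inv true  = exchange-inv t r

    ex-ε : ∀ s → ex s (ε , false) ≡ (ε , false)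
    ex-ε false = exchange-ε r t
    ex-ε true  = exchange-ε t r

  -- The reflection is its own inverse, so it can serve in both directions. For colours across, it
  -- admits the blocks with one total: `a ∙ b` and `c ∙ d` correspond when their sum is `e`.
  reflecting : Recolouring Carrier ε → Carrier → Recolouring (Carrier × Bool) (ε , false)
  reflecting P e = record { act = re ; act-inv = re-inv ; act-ε = λ s → cong (_, false) (act-ε P s) }
    where
    re : Bool → Carrier × Bool → Carrier × Bool
    re s (k , false) = act P s k , false
    re s (k , true)  = e ∙ k ⁻¹ , true

    re-inv : ∀ s x → re (not s) (re s x) ≡ x
    re-inv s (k , false) = cong (_, false) (act-inv P s k)
    re-inv s (k , true)  = cong (_, true) (sym (∙≡⇒≡∙⁻¹ (∙⁻¹-swap k e)))

-- The doubling step

Distinct₄ : {A : Set} (a b c d : A) → Set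
Distinct₄ a b c d = Distinct₃ a b c × a ≢ d × b ≢ d × c ≢ d

-- A quadruple system on two copies of A with no block inside either copy.
record Crossing (A : Set) : Set where
  field
    skein  : Skein (A × Bool)
    leaves : ∀ i {a b c} → Distinct₃ a b c →
             proj₂ (op skein (a , i) (b , i) (c , i)) ≡ not i

open Crossing

-- The induction hypothesis for `N` points. `pure` is the large set. `rest` has `N - 3` elements, as
-- many as there are points that can complete a triple to a block, so lengths are stated without
-- subtraction. `mixed-count` asks the crossing systems and the colour permutations to cover each 2
-- + 2 block `μ` times between them.
record Stage (μ : ℕ) (G : Points) : Set where
  open Points G
  open Points (twice G) using () renaming (_≟_ to _≟₂_)
  field
    colouring : Colouring Carrier ε
    e₀ e₁ e₂  : Carrier
    rest      : List Carrier

  enum : List Carrier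
  enum = e₀ ∷ e₁ ∷ e₂ ∷ rest

  field
    enum-once      : ∀ x → tally (λ y → ♯ (x ≟ y)) enum ≡ 1
    pure           : List (Skein Carrier)
    perms          : List (Recolouring Carrier ε)
    cross          : List (Crossing Carrier)
    pure-length    : length pure ≡ μ * length rest
    perms-length   : length perms ≡ μ * length rest
    cross-length   : length cross ≡ μ * length enum
    pure-count     : ∀ {a b c d} → Distinct₄ a b c d →
                     tally (λ S → ♯ (op S a b c ≟ d)) pure ≡ μ
    cross-count    : ∀ i {a b c} → Distinct₃ a b c → ∀ d →
                     tally (λ E → ♯ (op (skein E) (a , i) (b , i) (c , i) ≟₂ (d , not i))) cross ≡ μ
    mixed-count    : ∀ {a b c d} → a ≢ b → c ≢ d →
                     tally (λ E → ♯ (op (skein E) (a , false) (b , false) (c , true) ≟₂ (d , true))) cross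
                     + tally (λ P → ♯ (act P false (colour colouring a b) ≟ colour colouring c d)) perms
                     ≡ μ

-- The last component of the result is the half for a double taken along the
-- level, or along level + side if u is true.
turn : Bool → ((A × Bool) × Bool) ↔ ((A × Bool) × Bool)
turn {A} u = mk↔ₛ′ (λ ((x , v) , σ) → (x , σ) , (u ∧ σ) xor v)
               (λ ((x , σ) , w) → (x , (u ∧ σ) xor w) , σ)
               (λ ((x , σ) , w) → cong ((x , σ) ,_) (xor-cancel (u ∧ σ) w))
               (λ ((x , v) , σ) → cong (λ v → (x , v) , σ) (xor-cancel (u ∧ σ) v))
  where
  xor-cancel : ∀ i j → i xor (i xor j) ≡ j
  xor-cancel false j = refl
  xor-cancel true  j = not-involutive j

module Step {μ : ℕ} {G : Points} (St : Stage μ G) where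
  open Points G
  open Stage St
  G₂ = twice G
  G₄ = twice G₂
  open Points G₂ using () renaming (_≟_ to _≟₂_)
  open Points G₄ using () renaming (_≟_ to _≟₄_)

  C = colouring

  C₂ : Colouring (Carrier × Bool) (ε , false)
  C₂ = twiceColouring G C

  -- As long as `cross`, so that the two can be zipped; a condition on `t` with a single solution
  -- counts `μ` here.
  shifts : List Carrier
  shifts = copies μ enum

  tally-shifts : ∀ x → tally (λ t → ♯ (x ≟ t)) shifts ≡ μ
  tally-shifts x = trans (tally-copies _ μ enum) (trans (cong (μ *_) (enum-once x)) (ℕ.*-identityʳ μ))

  unique-shift : {Q : Carrier → Set} (Q? : ∀ t → Dec (Q t)) (t₀ : Carrier) →
                 (∀ t → Q t → t₀ ≡ t) → Q t₀ → tally (λ t → ♯ (Q? t)) shifts ≡ μ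
  unique-shift Q? t₀ only ok =
    trans (tally-cong (λ t → ♯-cong (Q? t) (t₀ ≟ t) (only t) λ { refl → ok }) shifts)
          (tally-shifts t₀)

  -- The two missed colours are chosen with sum `e`. Hence the blocks whose colours both stay across
  -- have total `e`, whatever `t` is.
  exchanger : Carrier → Carrier → Recolouring (Carrier × Bool) (ε , false)
  exchanger e t = exchanging G (e ∙ t ⁻¹) t

  exLink : Carrier → Carrier → Link (Carrier × Bool)
  exLink e t = colourLink C₂ (exchanger e t)

  -- The translation of the inside colours: by `t` forwards, and by the other missed colour in the
  -- inverse direction.
  drift : Bool → Carrier → Carrier → Carrier
  drift false e t = t
  drift true  e t = e ∙ t ⁻¹

  colour₂-within : ∀ i a b → colour C₂ (a , i) (b , i) ≡ (colour C a b , false)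
  colour₂-within false a b = refl
  colour₂-within true  a b = refl

  act-within : ∀ s e t {k} → k ≢ ε → act (exchanger e t) s (k , false) ≡ (k ∙ drift s e t , true)
  act-within false e t = exchange-within G (e ∙ t ⁻¹) t
  act-within true  e t = exchange-within G t (e ∙ t ⁻¹)

  -- Two points on one side have an inside colour, which the exchange moves across; so the fourth
  -- point lies on the side opposite to `c`.
  link-within : ∀ s e t i j {a b} c → a ≢ b →
                link (exLink e t) s (a , i) (b , i) (c , j)
                ≡ (colour C a b ∙ drift s e t ∙ c ⁻¹ , not j)
  link-within s e t i j {a} {b} c a≢b =
    cong (partner C₂ (c , j)) (trans (cong (act (exchanger e t) s) (colour₂-within i a b))
                                     (act-within s e t (colour≢ε C a≢b)))

  -- Three points on one side send their fourth point to the other side for one of two reasons: if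
  -- they share a half, because `E` is crossing; if they are split between the halves, by
  -- `link-within`.
  weave : Carrier → Bool → Crossing Carrier × Carrier → Crossing (Carrier × Bool)
  weave e u (E , t) = record
    { skein  = transport (turn u) (double (skein E) (exLink e t))
    ; leaves = λ i {(a , v₁)} {(b , v₂)} {(c , v₃)} (x≢y , x≢z , y≢z) →
        leaves′ i ((u ∧ i) xor v₁) ((u ∧ i) xor v₂) ((u ∧ i) xor v₃)
          (λ { refl eq → x≢y (cong (a ,_) (xor-injective (u ∧ i) eq)) })
          (λ { refl eq → x≢z (cong (a ,_) (xor-injective (u ∧ i) eq)) })
          (λ { refl eq → y≢z (cong (b ,_) (xor-injective (u ∧ i) eq)) })
    }
    where
    xor-injective : ∀ i {j k} → i xor j ≡ i xor k → j ≡ k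
    xor-injective false eq = eq
    xor-injective true  eq = trans (sym (not-involutive _)) (trans (cong not eq) (not-involutive _))

    side : ∀ s i {a b} c → (a ≡ b → s ≢ s) →
           proj₂ (link (exLink e t) s (a , i) (b , i) (c , i)) ≡ not i
    side s i c a≢b = cong proj₂ (link-within s e t i i c λ eq → a≢b eq refl)

    -- Distinctness of two points is put as an implication between their coordinates, so that equal
    -- halves yield distinct elements of `Carrier` by applying it to `refl`.
    leaves′ : ∀ i w₁ w₂ w₃ {a b c} → (a ≡ b → w₁ ≢ w₂) → (a ≡ c → w₁ ≢ w₃) → (b ≡ c → w₂ ≢ w₃) →
              proj₂ (proj₁ (op (double (skein E) (exLink e t))
                               ((a , i) , w₁) ((b , i) , w₂) ((c , i) , w₃))) ≡ not i
    leaves′ i false false false p q r = leaves E i ((λ eq → p eq refl) , (λ eq → q eq refl) , λ eq → r eq refl)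
    leaves′ i true  true  true  p q r = leaves E i ((λ eq → p eq refl) , (λ eq → q eq refl) , λ eq → r eq refl)
    leaves′ i false false true  p q r = side false i _ p
    leaves′ i true  true  false p q r = side true i _ p
    leaves′ i false true  false p q r = side false i _ q
    leaves′ i true  false true  p q r = side true i _ q
    leaves′ i true  false false p q r = side false i _ r
    leaves′ i false true  true  p q r = side true i _ r

  pairs : List (Crossing Carrier × Carrier)
  pairs = zip cross shifts

  pairs-length : length cross ≡ length shifts
  pairs-length = trans cross-length (sym (length-copies μ enum))

  pure₂ : List (Skein (Carrier × Bool))
  pure₂ = map (λ (S , P) → double S (colourLink C P)) (zip pure perms) ++ map skein cross

  -- There are as many old permutations as entries in `copies μ rest`, so each is paired with one
  -- reflection. The reflections preserve the kind of a colour; the exchanges with sum `e₂` are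
  -- there for pairs of one inside colour and one across.
  perms₂ : List (Recolouring (Carrier × Bool) (ε , false))
  perms₂ = map (λ (P , e) → reflecting G P e) (zip perms (copies μ rest)) ++ map (exchanger e₂) shifts

  cross₂ : List (Crossing (Carrier × Bool))
  cross₂ = map (weave e₀ false) pairs ++ map (weave e₁ true) pairs

-- Counts over the exchanges and the woven systems

module StepCounts {μ : ℕ} {G : Points} (St : Stage μ G) where
  open Points G
  open Stage St
  open Step St
  open Points G₂ using () renaming (_≟_ to _≟₂_)
  open Points G₄ using () renaming (_≟_ to _≟₄_)

  drift-involutive : ∀ s e t → drift s e (drift s e t) ≡ t
  drift-involutive false e t = refl
  drift-involutive true  e t = sym (∙≡⇒≡∙⁻¹ (∙⁻¹-swap t e))

  -- The colours `k` and `y` determine the translation, and `drift s e` is an involution in `t`, so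
  -- exactly one `t` fits.
  within-count : ∀ s e {k} → k ≢ ε → ∀ y →
                 tally (λ t → ♯ (act (exchanger e t) s (k , false) ≟₂ (y , true))) shifts ≡ μ
  within-count s e {k} k≢ε y = unique-shift
    (λ t → act (exchanger e t) s (k , false) ≟₂ (y , true)) (drift s e (y ∙ k ⁻¹))
    (λ t eq → trans (cong (drift s e) (sym (∙≡⇒≡∙⁻¹ (trans (comm _ k)
                      (cong proj₁ (trans (sym (act-within s e t k≢ε)) eq))))))
                    (drift-involutive s e t))
    (trans (act-within s e _ k≢ε)
           (cong (_, true) (trans (cong (k ∙_) (drift-involutive s e _)) (∙⁻¹-swap k y))))

  -- Passing to the inverse permutation gives `within-count` in the opposite direction.
  across-count : ∀ s e {k} → k ≢ ε → ∀ y →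
                 tally (λ t → ♯ (act (exchanger e t) s (y , true) ≟₂ (k , false))) shifts ≡ μ
  across-count s e {k} k≢ε y = trans
    (tally-cong (λ t → ♯-cong (_ ≟₂ _) (_ ≟₂ _) (act-flip (exchanger e t) s) (flip′ s t)) shifts)
    (within-count (not s) e k≢ε y)
    where
    flip′ : ∀ s t → act (exchanger e t) (not s) (k , false) ≡ (y , true) →
            act (exchanger e t) s (y , true) ≡ (k , false)
    flip′ false t = act-flip (exchanger e t) true
    flip′ true  t = act-flip (exchanger e t) false

  within-none : ∀ s e {k} → k ≢ ε → ∀ l →
                tally (λ t → ♯ (act (exchanger e t) s (k , false) ≟₂ (l , false))) shifts ≡ 0
  within-none s e k≢ε l =
    tally-zero (λ t → ♯-no (_ ≟₂ _) λ eq →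
      case trans (sym (act-within s e t k≢ε)) eq of λ ()) shifts

  -- Only the missed colour stays across, and forwards it goes from `e ∙ t ⁻¹` to `t`. So `t` must
  -- be `y`, and then `x ∙ y` must be `e`. The backward direction is the same with `x` and `y`
  -- interchanged.
  missed-count : ∀ s e x y →
                 tally (λ t → ♯ (act (exchanger e t) s (x , true) ≟₂ (y , true))) shifts
                 ≡ μ * ♯ (x ∙ y ≟ e)
  missed-count true e x y = trans
    (tally-cong (λ t → ♯-cong (_ ≟₂ _) (_ ≟₂ _) (act-flip (exchanger e t) true)
                                                  (act-flip (exchanger e t) false)) shifts)
    (trans (missed-count false e y x) (cong (λ z → μ * ♯ (z ≟ e)) (comm y x)))
  missed-count false e x y with x ∙ y ≟ e
  ... | yes xy≡e = trans
    (unique-shift (λ t → act (exchanger e t) false (x , true) ≟₂ (y , true)) y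
      (λ t eq → sym (proj₂ (exchange-missed⁻¹ G (e ∙ t ⁻¹) t eq)))
      (trans (cong (λ r → exchange G (e ∙ y ⁻¹) y (r , true)) (∙≡⇒≡∙⁻¹ xy≡e))
             (exchange-missed G (e ∙ y ⁻¹) y)))
    (sym (ℕ.*-identityʳ μ))
  ... | no  xy≢e = trans
    (tally-zero (λ t → ♯-no (_ ≟₂ _) λ eq →
      case exchange-missed⁻¹ G (e ∙ t ⁻¹) t eq of λ
        { (x≡ , refl) → xy≢e (≡∙⁻¹⇒∙≡ x≡) }) shifts)
    (sym (ℕ.*-zeroʳ μ))

  colour₂-across : ∀ i a b → colour C₂ (a , i) (b , not i) ≡ (a ∙ b , true)
  colour₂-across false a b = refl
  colour₂-across true  a b = refl

  -- The link depends on `t` alone, so the crossing systems drop out of the count and an equation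
  -- between colours is left.
  link-tally : ∀ s e (x y z w : Carrier × Bool) →
               tally (λ (E , t) → ♯ (link (exLink e t) s x y z ≟₂ w)) pairs
               ≡ tally (λ t → ♯ (act (exchanger e t) s (colour C₂ x y) ≟₂ colour C₂ z w)) shifts
  link-tally s e x y z w = trans
    (tally-cong (λ (E , t) → ♯-cong (_ ≟₂ _) (_ ≟₂ _) (link⇒act C₂ (exchanger e t) s)
                                                        (act⇒link C₂ (exchanger e t) s)) pairs)
    (tally-zip₂ (λ t → ♯ (act (exchanger e t) s (colour C₂ x y) ≟₂ colour C₂ z w))
                cross shifts pairs-length)

  half-count : (h : Crossing Carrier × Carrier → Carrier × Bool) → ∀ s {x w n} →
               tally (λ z → ♯ (h z ≟₂ x)) pairs ≡ n →
               tally (λ z → ♯ ((h z , s) ≟₄ (x , w))) pairs ≡ (if does (w ≟ᵇ s) then n else 0)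
  half-count h s {x} {w} eq with w ≟ᵇ s
  ... | yes refl = trans (tally-cong (λ z → ♯-cong (_ ≟₄ _) (h z ≟₂ x) (cong proj₁) (cong (_, s))) pairs) eq
  ... | no  w≢s  = tally-zero (λ z → ♯-no (_ ≟₄ _) (w≢s ∘ sym ∘ cong proj₂)) pairs

  weave-tally : ∀ e u x y z w →
    tally (λ E → ♯ (op (skein E) x y z ≟₄ w)) (map (weave e u) pairs)
    ≡ tally (λ (E , t) → ♯ (op (double (skein E) (exLink e t)) (Inverse.to (turn u) x)
                               (Inverse.to (turn u) y) (Inverse.to (turn u) z)
                            ≟₄ Inverse.to (turn u) w)) pairs
  weave-tally e u x y z w = trans (tally-map _ (weave e u) pairs)
    (tally-cong (λ (E , t) → ♯-cong (_ ≟₄ _) (_ ≟₄ _)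
      (λ eq → trans (sym (strictlyInverseˡ _)) (cong to eq))
      (λ eq → trans (cong from eq) (strictlyInverseʳ w))) pairs)
    where open Inverse (turn u)

  module _ (e : Carrier) (i : Bool) where

    link-count : ∀ s {a b} → a ≢ b → ∀ c d →
                 tally (λ (E , t) → ♯ (link (exLink e t) s (a , i) (b , i) (c , i) ≟₂ (d , not i))) pairs ≡ μ
    link-count s {a} {b} a≢b c d = begin
      tally (λ (E , t) → ♯ (link (exLink e t) s (a , i) (b , i) (c , i) ≟₂ (d , not i))) pairs
        ≡⟨ link-tally s e (a , i) (b , i) (c , i) (d , not i) ⟩
      tally (λ t → ♯ (act (exchanger e t) s (colour C₂ (a , i) (b , i)) ≟₂ colour C₂ (c , i) (d , not i))) shifts
        ≡⟨ cong₂ (λ k l → tally (λ t → ♯ (act (exchanger e t) s k ≟₂ l)) shifts)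
                 (colour₂-within i a b) (colour₂-across i c d) ⟩
      tally (λ t → ♯ (act (exchanger e t) s (colour C a b , false) ≟₂ (c ∙ d , true))) shifts
        ≡⟨ within-count s e (colour≢ε C a≢b) (c ∙ d) ⟩
      μ ∎
      where open ≡-Reasoning

    -- A block meets each half in an even number of points, which fixes the half of the fourth
    -- point. There the count is `cross-count` if the three halves agree, and `link-count` if they
    -- do not.
    one-side-count : ∀ w₁ w₂ w₃ {a b c} → (a ≡ b → w₁ ≢ w₂) → (a ≡ c → w₁ ≢ w₃) → (b ≡ c → w₂ ≢ w₃) →
      ∀ d w →
      tally (λ (E , t) → ♯ (op (double (skein E) (exLink e t)) ((a , i) , w₁) ((b , i) , w₂) ((c , i) , w₃)
                            ≟₄ ((d , not i) , w))) pairs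
      ≡ (if does (w ≟ᵇ w₁ xor (w₂ xor w₃)) then μ else 0)
    one-side-count w₁ w₂ w₃ p q r d w = go w₁ w₂ w₃ p q r
      where
      pure-half : ∀ s {a b c} → (a ≡ b → s ≢ s) → (a ≡ c → s ≢ s) → (b ≡ c → s ≢ s) →
        tally (λ (E , t) → ♯ ((op (skein E) (a , i) (b , i) (c , i) , s) ≟₄ ((d , not i) , w))) pairs
        ≡ (if does (w ≟ᵇ s) then μ else 0)
      pure-half s {a} {b} {c} p q r = half-count (λ (E , t) → op (skein E) (a , i) (b , i) (c , i)) s
        (trans (tally-zip₁ (λ E → ♯ (op (skein E) (a , i) (b , i) (c , i) ≟₂ (d , not i))) cross shifts pairs-length)
               (cross-count i ((λ eq → p eq refl) , (λ eq → q eq refl) , λ eq → r eq refl) d))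

      split : ∀ s s′ {a b} c → (a ≡ b → s ≢ s) →
        tally (λ (E , t) → ♯ ((link (exLink e t) s (a , i) (b , i) (c , i) , s′) ≟₄ ((d , not i) , w))) pairs
        ≡ (if does (w ≟ᵇ s′) then μ else 0)
      split s s′ c p = half-count _ s′ (link-count s (λ eq → p eq refl) c d)

      go : ∀ w₁ w₂ w₃ {a b c} → (a ≡ b → w₁ ≢ w₂) → (a ≡ c → w₁ ≢ w₃) → (b ≡ c → w₂ ≢ w₃) →
        tally (λ (E , t) → ♯ (op (double (skein E) (exLink e t)) ((a , i) , w₁) ((b , i) , w₂) ((c , i) , w₃)
                              ≟₄ ((d , not i) , w))) pairs
        ≡ (if does (w ≟ᵇ w₁ xor (w₂ xor w₃)) then μ else 0)
      go false false false p q r = pure-half false p q r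
      go true  true  true  p q r = pure-half true p q r
      go false false true  p q r = split false true _ p
      go true  true  false p q r = split true false _ p
      go false true  false p q r = split false true _ q
      go true  false true  p q r = split true false _ q
      go true  false false p q r = split false true _ r
      go false true  true  p q r = split true false _ r

-- The second direction alters the halves of the points on side `true`. With three points on one
-- side and one on the other, that is an odd number of changes, so the parity condition holds in
-- exactly one of the two directions.
xor-parity : ∀ m i w v₁ v₂ v₃ →
  (if does ((false ∧ not i) xor w ≟ᵇ ((false ∧ i) xor v₁) xor (((false ∧ i) xor v₂) xor ((false ∧ i) xor v₃))) then m else 0)
  + (if does ((true ∧ not i) xor w ≟ᵇ ((true ∧ i) xor v₁) xor (((true ∧ i) xor v₂) xor ((true ∧ i) xor v₃))) then m else 0)
  ≡ m
xor-parity m false w v₁ v₂ v₃ = exactly-one w (v₁ xor (v₂ xor v₃))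
  where
  exactly-one : ∀ w v → (if does (w ≟ᵇ v) then m else 0) + (if does (not w ≟ᵇ v) then m else 0) ≡ m
  exactly-one false false = ℕ.+-identityʳ m
  exactly-one false true  = refl
  exactly-one true  false = refl
  exactly-one true  true  = ℕ.+-identityʳ m
xor-parity m true w v₁ v₂ v₃ =
  trans (cong (λ p → (if does (w ≟ᵇ v₁ xor (v₂ xor v₃)) then m else 0) + (if does (w ≟ᵇ p) then m else 0))
              (not-parity v₁ v₂ v₃))
        (exactly-one w (v₁ xor (v₂ xor v₃)))
  where
  not-parity : ∀ i j k → not i xor (not j xor not k) ≡ not (i xor (j xor k))
  not-parity false false k = not-involutive _
  not-parity false true  k = refl
  not-parity true  false k = refl
  not-parity true  true  k = sym (not-involutive _)

  exactly-one : ∀ w v → (if does (w ≟ᵇ v) then m else 0) + (if does (w ≟ᵇ not v) then m else 0) ≡ m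
  exactly-one false false = ℕ.+-identityʳ m
  exactly-one false true  = refl
  exactly-one true  false = refl
  exactly-one true  true  = ℕ.+-identityʳ m

-- Crossing systems and colour permutations of the next stage

module StepStage {μ : ℕ} {G : Points} (St : Stage μ G) where
  open Points G
  open Stage St
  open Step St
  open StepCounts St
  open Points G₂ using () renaming (_≟_ to _≟₂_)
  open Points G₄ using () renaming (_≟_ to _≟₄_)

  cross₂-count : ∀ i {x y z} → Distinct₃ x y z → ∀ w →
                 tally (λ E → ♯ (op (skein E) (x , i) (y , i) (z , i) ≟₄ (w , not i))) cross₂ ≡ μ
  cross₂-count i {a , v₁} {b , v₂} {c , v₃} (x≢y , x≢z , y≢z) (d , v) =
    trans (tally-++ _ (map (weave e₀ false) pairs) _)
      (trans (cong₂ _+_ (part e₀ false) (part e₁ true)) (xor-parity μ i v v₁ v₂ v₃))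
    where
    xor-≢ : ∀ i {j k} → j ≢ k → i xor j ≢ i xor k
    xor-≢ false j≢k = j≢k
    xor-≢ true  {j} {k} j≢k eq = j≢k (trans (sym (not-involutive j)) (trans (cong not eq) (not-involutive k)))

    part : ∀ e u → tally (λ E → ♯ (op (skein E) ((a , v₁) , i) ((b , v₂) , i) ((c , v₃) , i) ≟₄ ((d , v) , not i)))
                         (map (weave e u) pairs)
                   ≡ (if does ((u ∧ not i) xor v ≟ᵇ ((u ∧ i) xor v₁) xor (((u ∧ i) xor v₂) xor ((u ∧ i) xor v₃)))
                      then μ else 0)
    part e u = trans (weave-tally e u ((a , v₁) , i) ((b , v₂) , i) ((c , v₃) , i) ((d , v) , not i))
      (one-side-count e i ((u ∧ i) xor v₁) ((u ∧ i) xor v₂) ((u ∧ i) xor v₃)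
        (λ { refl → xor-≢ (u ∧ i) λ eq → x≢y (cong (a ,_) eq) })
        (λ { refl → xor-≢ (u ∧ i) λ eq → x≢z (cong (a ,_) eq) })
        (λ { refl → xor-≢ (u ∧ i) λ eq → y≢z (cong (b ,_) eq) })
        d ((u ∧ not i) xor v))

  cross₂-length : length cross₂ ≡ μ * length (map (_, false) enum ++ map (_, true) enum)
  cross₂-length = begin
    length cross₂
      ≡⟨ length-++ (map (weave e₀ false) pairs) ⟩
    length (map (weave e₀ false) pairs) + length (map (weave e₁ true) pairs)
      ≡⟨ cong₂ _+_ (length-map _ pairs) (length-map _ pairs) ⟩
    length pairs + length pairs
      ≡⟨ cong (λ l → l + l) (trans (length-zip cross shifts pairs-length) cross-length) ⟩
    μ * length enum + μ * length enum
      ≡⟨ ℕ.*-distribˡ-+ μ (length enum) (length enum) ⟨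
    μ * (length enum + length enum)
      ≡⟨ cong (μ *_) (trans (length-++ (map (_, false) enum))
                            (cong₂ _+_ (length-map _ enum) (length-map _ enum))) ⟨
    μ * length (map (_, false) enum ++ map (_, true) enum) ∎
    where open ≡-Reasoning

  -- The next `e₀`, `e₁`, `e₂` are the `false` copies of the old ones, so the next enumeration
  -- unfolds to two full copies of `enum`. For `N` old points the length is `(N - 3) + N = 2N - 3`,
  -- which matches the doubles and the crossing systems taken together.
  rest₂ : List (Carrier × Bool)
  rest₂ = map (_, false) rest ++ map (_, true) enum

  rest₂-length : μ * length rest₂ ≡ μ * length rest + μ * length enum
  rest₂-length = trans
    (cong (μ *_) (trans (length-++ (map (_, false) rest)) (cong₂ _+_ (length-map _ rest) (length-map _ enum))))
    (ℕ.*-distribˡ-+ μ (length rest) (length enum))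

  reflections : List (Recolouring Carrier ε × Carrier)
  reflections = zip perms (copies μ rest)

  reflections-length : length perms ≡ length (copies μ rest)
  reflections-length = trans perms-length (sym (length-copies μ rest))

  perms₂-length : length perms₂ ≡ μ * length rest₂
  perms₂-length = begin
    length perms₂
      ≡⟨ length-++ (map (λ (P , e) → reflecting G P e) reflections) ⟩
    length (map (λ (P , e) → reflecting G P e) reflections) + length (map (exchanger e₂) shifts)
      ≡⟨ cong₂ _+_ (trans (length-map _ reflections)
                          (trans (length-zip perms _ reflections-length) perms-length))
                   (trans (length-map _ shifts) (length-copies μ enum)) ⟩
    μ * length rest + μ * length enum
      ≡⟨ rest₂-length ⟨
    μ * length rest₂ ∎
    where open ≡-Reasoning

  systems : List (Skein Carrier × Recolouring Carrier ε)
  systems = zip pure perms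

  systems-length : length pure ≡ length perms
  systems-length = trans pure-length (sym perms-length)

  pure₂-length : length pure₂ ≡ μ * length rest₂
  pure₂-length = begin
    length pure₂
      ≡⟨ length-++ (map (λ (S , P) → double S (colourLink C P)) systems) ⟩
    length (map (λ (S , P) → double S (colourLink C P)) systems) + length (map skein cross)
      ≡⟨ cong₂ _+_ (trans (length-map _ systems)
                          (trans (length-zip pure perms systems-length) pure-length))
                   (trans (length-map _ cross) cross-length) ⟩
    μ * length rest + μ * length enum
      ≡⟨ rest₂-length ⟨
    μ * length rest₂ ∎
    where open ≡-Reasoning

  enum₂-once : ∀ x → tally (λ y → ♯ (x ≟₂ y)) (map (_, false) enum ++ map (_, true) enum) ≡ 1
  enum₂-once (x , i) = trans (tally-++ hit (map (_, false) enum) (map (_, true) enum))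
    (trans (cong₂ _+_ (tally-map hit (_, false) enum) (tally-map hit (_, true) enum)) (count i))
    where
    hit : Carrier × Bool → ℕ
    hit y = ♯ ((x , i) ≟₂ y)

    same : ∀ i → tally (λ y → ♯ ((x , i) ≟₂ (y , i))) enum ≡ 1
    same i = trans (tally-cong (λ y → ♯-cong ((x , i) ≟₂ (y , i)) (x ≟ y) (cong proj₁) (cong (_, i))) enum)
                   (enum-once x)

    other : ∀ {i j} → i ≢ j → tally (λ y → ♯ ((x , i) ≟₂ (y , j))) enum ≡ 0
    other i≢j = tally-zero (λ y → ♯-no (_ ≟₂ _) (i≢j ∘ cong proj₂)) enum

    count : ∀ i → tally (λ y → ♯ ((x , i) ≟₂ (y , false))) enum
                  + tally (λ y → ♯ ((x , i) ≟₂ (y , true))) enum ≡ 1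
    count false = cong₂ _+_ (same false) (other λ ())
    count true  = cong₂ _+_ (other λ ()) (same true)

  module _ {a b c d : Carrier} where

    level-count : ℕ
    level-count = tally (λ E → ♯ (op (skein E) (a , false) (b , false) (c , true) ≟₂ (d , true))) cross

    σ : Carrier
    σ = a ∙ b ∙ (c ∙ d)

    woven : Carrier → (p q r s : Bool) → ℕ
    woven e p q r s =
      tally (λ (E , t) → ♯ (op (double (skein E) (exLink e t)) ((a , false) , p) ((b , false) , q) ((c , true) , r)
                            ≟₄ ((d , true) , s))) pairs

    -- The flags are the halves of the four points. In a common half the old crossing systems
    -- decide. If each half has one point of each side, the colours must both stay across, which
    -- `missed-count` counts. If the halves are `a`, `b` and `c`, `d`, an inside colour would have
    -- to stay inside, which never happens. An odd split is impossible.
    expected : Carrier → (p q r s : Bool) → ℕ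
    expected e false false false false = level-count
    expected e true  true  true  true  = level-count
    expected e false true  false true  = μ * ♯ (σ ≟ e)
    expected e true  false true  false = μ * ♯ (σ ≟ e)
    expected e true  false false true  = μ * ♯ (σ ≟ e)
    expected e false true  true  false = μ * ♯ (σ ≟ e)
    expected e _     _     _     _     = 0

    woven-count : ∀ e p q r s → (p ≡ q → a ≢ b) → woven e p q r s ≡ expected e p q r s
    woven-count e = go
      where
      within : ∀ s → tally (λ (E , t) → ♯ ((op (skein E) (a , false) (b , false) (c , true) , s) ≟₄ ((d , true) , s))) pairs
                     ≡ (if does (s ≟ᵇ s) then level-count else 0)
      within s = half-count (λ (E , t) → op (skein E) (a , false) (b , false) (c , true)) s
        (tally-zip₁ (λ E → ♯ (op (skein E) (a , false) (b , false) (c , true) ≟₂ (d , true))) cross shifts pairs-length)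

      miss : (h : Crossing Carrier × Carrier → Carrier × Bool) → ∀ {s w} → s ≢ w →
             tally (λ z → ♯ ((h z , s) ≟₄ ((d , true) , w))) pairs ≡ 0
      miss h s≢w = tally-zero (λ z → ♯-no (_ ≟₄ _) (s≢w ∘ cong proj₂)) pairs

      bent : ∀ s s′ w → a ≢ b →
             tally (λ (E , t) → ♯ ((link (exLink e t) s (a , false) (b , false) (c , true) , s′) ≟₄ ((d , true) , w))) pairs ≡ 0
      bent s s′ w a≢b = tally-zero (λ (E , t) → ♯-no (_ ≟₄ _) λ eq →
        case trans (sym (link-within s e t false true c a≢b)) (cong proj₁ eq) of λ ()) pairs

      straight : ∀ s {x y} → x ∙ c ∙ (y ∙ d) ≡ σ →
                 tally (λ (E , t) → ♯ (link (exLink e t) s (x , false) (c , true) (y , false) ≟₂ (d , true))) pairs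
                 ≡ μ * ♯ (σ ≟ e)
      straight s {x} {y} eq = trans (link-tally s e (x , false) (c , true) (y , false) (d , true))
        (trans (missed-count s e (x ∙ c) (y ∙ d)) (cong (λ z → μ * ♯ (z ≟ e)) eq))

      acbd : a ∙ c ∙ (b ∙ d) ≡ σ
      acbd = interchange a c b d

      bcad : b ∙ c ∙ (a ∙ d) ≡ σ
      bcad = trans (interchange b c a d) (cong (_∙ (c ∙ d)) (comm b a))

      go : ∀ p q r s → (p ≡ q → a ≢ b) → woven e p q r s ≡ expected e p q r s
      go false false false false a≢b = within false
      go true  true  true  true  a≢b = within true
      go false false false true  a≢b = miss _ λ ()
      go true  true  true  false a≢b = miss _ λ ()
      go false false true  false a≢b = bent false true false (a≢b refl)
      go false false true  true  a≢b = bent false true true (a≢b refl)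
      go true  true  false false a≢b = bent true false false (a≢b refl)
      go true  true  false true  a≢b = bent true false true (a≢b refl)
      go false true  false true  a≢b = half-count _ true (straight false acbd)
      go true  false true  false a≢b = half-count _ false (straight true acbd)
      go true  false false true  a≢b = half-count _ true (straight false bcad)
      go false true  true  false a≢b = half-count _ false (straight true bcad)
      go false true  false false a≢b = miss _ λ ()
      go true  false true  true  a≢b = miss _ λ ()
      go true  false false false a≢b = miss _ λ ()
      go false true  true  true  a≢b = miss _ λ ()

    recoloured : (k l : Carrier × Bool) → ℕ
    recoloured k l = tally (λ P → ♯ (act P false k ≟₂ l)) perms₂

    recoloured-split : ∀ k l {m n} →
      tally (λ (P , e) → ♯ (act (reflecting G P e) false k ≟₂ l)) reflections ≡ m →
      tally (λ t → ♯ (act (exchanger e₂ t) false k ≟₂ l)) shifts ≡ n →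
      recoloured k l ≡ m + n
    recoloured-split k l eq₁ eq₂ =
      trans (tally-++ hit (map (λ (P , e) → reflecting G P e) reflections) _)
            (cong₂ _+_ (trans (tally-map hit _ reflections) eq₁) (trans (tally-map hit _ shifts) eq₂))
      where
      hit : Recolouring (Carrier × Bool) (ε , false) → ℕ
      hit P = ♯ (act P false k ≟₂ l)

    -- The reflections act on inside colours by the old permutations, and the exchanges keep no
    -- inside colour inside.
    within-within : a ≢ b → recoloured (colour C a b , false) (colour C c d , false)
                            ≡ tally (λ P → ♯ (act P false (colour C a b) ≟ colour C c d)) perms
    within-within a≢b = trans
      (recoloured-split _ _
        (trans (tally-cong (λ (P , e) → ♯-cong (_ ≟₂ _) (_ ≟ _) (cong proj₁) (cong (_, false))) reflections)
               (tally-zip₁ (λ P → ♯ (act P false (colour C a b) ≟ colour C c d)) perms _ reflections-length))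
        (within-none false e₂ (colour≢ε C a≢b) _))
      (ℕ.+-identityʳ _)

    within-across : a ≢ b → recoloured (colour C a b , false) (c ∙ d , true) ≡ μ
    within-across a≢b = recoloured-split _ _
      (tally-zero (λ _ → ♯-no (_ ≟₂ _) λ ()) reflections)
      (within-count false e₂ (colour≢ε C a≢b) _)

    across-within : c ≢ d → recoloured (a ∙ b , true) (colour C c d , false) ≡ μ
    across-within c≢d = recoloured-split _ _
      (tally-zero (λ _ → ♯-no (_ ≟₂ _) λ ()) reflections)
      (across-count false e₂ (colour≢ε C c≢d) _)

    -- The reflection at `e` admits the block exactly when `σ ≡ e`, and the exchanges contribute
    -- only their missed pairs, for which `σ ≡ e₂`.
    across-across : recoloured (a ∙ b , true) (c ∙ d , true)
                    ≡ μ * tally (λ e → ♯ (σ ≟ e)) rest + μ * ♯ (σ ≟ e₂)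
    across-across = recoloured-split _ _
      (trans (tally-cong (λ (P , e) → ♯-cong (_ ≟₂ _) (σ ≟ e)
               (λ eq → trans (comm (a ∙ b) (c ∙ d)) (≡∙⁻¹⇒∙≡ (sym (cong proj₁ eq))))
               (λ eq → cong (_, true) (sym (∙≡⇒≡∙⁻¹ (trans (comm (c ∙ d) (a ∙ b)) eq))))) reflections)
        (trans (tally-zip₂ (λ e → ♯ (σ ≟ e)) perms _ reflections-length)
               (tally-copies _ μ rest)))
      (missed-count false e₂ _ _)

    -- The two directions of weaving account for `e₀` and `e₁`, the exchanges for `e₂`, the
    -- reflections for `rest`; and `σ` occurs exactly once in the whole enumeration.
    all-shifts : μ * ♯ (σ ≟ e₀) + μ * ♯ (σ ≟ e₁) + (μ * tally (λ e → ♯ (σ ≟ e)) rest + μ * ♯ (σ ≟ e₂)) ≡ μ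
    all-shifts = begin
      μ * h₀ + μ * h₁ + (μ * hᵣ + μ * h₂) ≡⟨ cong (μ * h₀ + μ * h₁ +_) (ℕ.*-distribˡ-+ μ hᵣ h₂) ⟨
      μ * h₀ + μ * h₁ + μ * (hᵣ + h₂)     ≡⟨ ℕ.+-assoc (μ * h₀) _ _ ⟩
      μ * h₀ + (μ * h₁ + μ * (hᵣ + h₂))   ≡⟨ cong (μ * h₀ +_) (ℕ.*-distribˡ-+ μ h₁ (hᵣ + h₂)) ⟨
      μ * h₀ + μ * (h₁ + (hᵣ + h₂))       ≡⟨ ℕ.*-distribˡ-+ μ h₀ _ ⟨
      μ * (h₀ + (h₁ + (hᵣ + h₂)))         ≡⟨ cong (λ h → μ * (h₀ + (h₁ + h))) (ℕ.+-comm hᵣ h₂) ⟩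
      μ * (h₀ + (h₁ + (h₂ + hᵣ)))         ≡⟨ cong (μ *_) (enum-once σ) ⟩
      μ * 1                               ≡⟨ ℕ.*-identityʳ μ ⟩
      μ                                   ∎
      where
      open ≡-Reasoning
      h₀ = ♯ (σ ≟ e₀)
      h₁ = ♯ (σ ≟ e₁)
      h₂ = ♯ (σ ≟ e₂)
      hᵣ = tally (λ e → ♯ (σ ≟ e)) rest

    -- If both pairs are level, one of the two directions puts all four points in a common half and
    -- the old `mixed-count` applies. If just one pair is level, no woven system has the block and
    -- the exchanges give `μ`. If neither is, the total `σ` decides, by `all-shifts`.
    mixed₂-count : ∀ i j k l → (a , i) ≢ (b , j) → (c , k) ≢ (d , l) →
      tally (λ E → ♯ (op (skein E) ((a , i) , false) ((b , j) , false) ((c , k) , true) ≟₄ ((d , l) , true))) cross₂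
      + recoloured (colour C₂ (a , i) (b , j)) (colour C₂ (c , k) (d , l)) ≡ μ
    mixed₂-count i j k l x≢y z≢w =
      trans (cong (_+ recoloured (colour C₂ (a , i) (b , j)) (colour C₂ (c , k) (d , l)))
              (trans (tally-++ _ (map (weave e₀ false) pairs) _)
                (cong₂ _+_ (trans (weave-tally e₀ false _ _ _ _) (woven-count e₀ i j k l a≢b))
                           -- In the second direction the points on side `true` change their half.
                           (trans (weave-tally e₁ true _ _ _ _) (woven-count e₁ i j (not k) (not l) a≢b)))))
            (total i j k l a≢b c≢d)
      where
      a≢b : i ≡ j → a ≢ b
      a≢b refl eq = x≢y (cong (_, i) eq)

      c≢d : k ≡ l → c ≢ d
      c≢d refl eq = z≢w (cong (_, k) eq)

      same₀ : a ≢ b → c ≢ d →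
                level-count + 0 + recoloured (colour C a b , false) (colour C c d , false) ≡ μ
      same₀ a≢b c≢d = trans (cong₂ _+_ (ℕ.+-identityʳ level-count) (within-within a≢b)) (mixed-count a≢b c≢d)

      same₁ : a ≢ b → c ≢ d →
                level-count + recoloured (colour C a b , false) (colour C c d , false) ≡ μ
      same₁ a≢b c≢d = trans (cong (level-count +_) (within-within a≢b)) (mixed-count a≢b c≢d)

      different : μ * ♯ (σ ≟ e₀) + μ * ♯ (σ ≟ e₁) + recoloured (a ∙ b , true) (c ∙ d , true) ≡ μ
      different = trans (cong (μ * ♯ (σ ≟ e₀) + μ * ♯ (σ ≟ e₁) +_) across-across) all-shifts

      total : ∀ i j k l → (i ≡ j → a ≢ b) → (k ≡ l → c ≢ d) →
              expected e₀ i j k l + expected e₁ i j (not k) (not l)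
              + recoloured (colour C₂ (a , i) (b , j)) (colour C₂ (c , k) (d , l)) ≡ μ
      total false false false false p q = same₀ (p refl) (q refl)
      total false false true  true  p q = same₁ (p refl) (q refl)
      total true  true  false false p q = same₁ (p refl) (q refl)
      total true  true  true  true  p q = same₀ (p refl) (q refl)
      total false false false true  p q = within-across (p refl)
      total false false true  false p q = within-across (p refl)
      total true  true  false true  p q = within-across (p refl)
      total true  true  true  false p q = within-across (p refl)
      total false true  false false p q = across-within (q refl)
      total false true  true  true  p q = across-within (q refl)
      total true  false false false p q = across-within (q refl)
      total true  false true  true  p q = across-within (q refl)
      total false true  false true  p q = different
      total false true  true  false p q = different
      total true  false false true  p q = different
      total true  false true  false p q = different

-- The large set on the doubled points

swap₁₂ : {a b c d : A} → Distinct₄ a b c d → Distinct₄ b a c d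
swap₁₂ ((ab , ac , bc) , ad , bd , cd) = (ab ∘ sym , bc , ac) , bd , ad , cd

swap₂₃ : {a b c d : A} → Distinct₄ a b c d → Distinct₄ a c b d
swap₂₃ ((ab , ac , bc) , ad , bd , cd) = (ac , ab , bc ∘ sym) , ad , cd , bd

swap₃₄ : {a b c d : A} → Distinct₄ a b c d → Distinct₄ a b d c
swap₃₄ ((ab , ac , bc) , ad , bd , cd) = (ab , ad , bd) , ac , bc , cd ∘ sym

module NextStage {μ : ℕ} {G : Points} (St : Stage μ G) where
  open Points G
  open Stage St
  open Step St
  open StepStage St
  open Points G₂ using () renaming (_≟_ to _≟₂_)

  blocks : (x y z w : Carrier × Bool) → ℕ
  blocks x y z w = tally (λ S → ♯ (op S x y z ≟₂ w)) pure₂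

  blocks₁₂ : ∀ x y z w → blocks x y z w ≡ blocks y x z w
  blocks₁₂ x y z w = tally-cong (λ S → cong (λ v → ♯ (v ≟₂ w)) (comm₁₂ S x y z)) pure₂

  blocks₂₃ : ∀ x y z w → blocks x y z w ≡ blocks x z y w
  blocks₂₃ x y z w = tally-cong (λ S → cong (λ v → ♯ (v ≟₂ w)) (comm₂₃ S x y z)) pure₂

  blocks₃₄ : ∀ x y z w → blocks x y z w ≡ blocks x y w z
  blocks₃₄ x y z w = tally-cong (λ S → ♯-cong (_ ≟₂ _) (_ ≟₂ _) (flip₃₄ S) (flip₃₄ S)) pure₂

  blocks-split : ∀ x y z w {m n} →
    tally (λ (S , P) → ♯ (op (double S (colourLink C P)) x y z ≟₂ w)) systems ≡ m →
    tally (λ E → ♯ (op (skein E) x y z ≟₂ w)) cross ≡ n →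
    blocks x y z w ≡ m + n
  blocks-split x y z w eq₁ eq₂ =
    trans (tally-++ hit (map (λ (S , P) → double S (colourLink C P)) systems) _)
          (cong₂ _+_ (trans (tally-map hit _ systems) eq₁) (trans (tally-map hit skein cross) eq₂))
    where
    hit : Skein (Carrier × Bool) → ℕ
    hit S = ♯ (op S x y z ≟₂ w)

  module _ {a b c d : Carrier} where

    within-half : ∀ i → Distinct₄ (a , i) (b , i) (c , i) (d , i) →
                  blocks (a , i) (b , i) (c , i) (d , i) ≡ μ
    within-half i ((ab , ac , bc) , ad , bd , cd) = trans
      (blocks-split (a , i) (b , i) (c , i) (d , i)
        (trans (tally-cong (λ (S , P) → doubled i S P) systems)
          (trans (tally-zip₁ (λ S → ♯ (op S a b c ≟ d)) pure perms systems-length) (pure-count distinct)))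
        (tally-zero (λ E → ♯-no (_ ≟₂ _) (leaves≢ i E)) cross))
      (ℕ.+-identityʳ μ)
      where
      distinct : Distinct₄ a b c d
      distinct = (ab ∘ cong (_, i) , ac ∘ cong (_, i) , bc ∘ cong (_, i))
               , ad ∘ cong (_, i) , bd ∘ cong (_, i) , cd ∘ cong (_, i)

      doubled : ∀ i S P → ♯ (op (double S (colourLink C P)) (a , i) (b , i) (c , i) ≟₂ (d , i))
                          ≡ ♯ (op S a b c ≟ d)
      doubled false S P = ♯-cong (_ ≟₂ _) (_ ≟ _) (cong proj₁) (cong (_, false))
      doubled true  S P = ♯-cong (_ ≟₂ _) (_ ≟ _) (cong proj₁) (cong (_, true))

      leaves≢ : ∀ i E → op (skein E) (a , i) (b , i) (c , i) ≢ (d , i)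
      leaves≢ i E eq with i | trans (sym (leaves E i (proj₁ distinct))) (cong proj₂ eq)
      ... | false | ()
      ... | true  | ()

    three-one : ∀ i → Distinct₄ (a , i) (b , i) (c , i) (d , not i) →
                blocks (a , i) (b , i) (c , i) (d , not i) ≡ μ
    three-one i ((ab , ac , bc) , _) = blocks-split (a , i) (b , i) (c , i) (d , not i)
      (tally-zero (λ (S , P) → ♯-no (_ ≟₂ _) (stays i S P)) systems)
      (cross-count i (ab ∘ cong (_, i) , ac ∘ cong (_, i) , bc ∘ cong (_, i)) d)
      where
      stays : ∀ i S P → op (double S (colourLink C P)) (a , i) (b , i) (c , i) ≢ (d , not i)
      stays false S P ()
      stays true  S P ()

    -- A double has this block exactly when its permutation takes the first colour to the second,
    -- which is what the second summand of `mixed-count` counts.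
    two-two : Distinct₄ (a , false) (b , false) (c , true) (d , true) →
              blocks (a , false) (b , false) (c , true) (d , true) ≡ μ
    two-two ((ab , _) , _ , _ , cd) = trans
      (blocks-split (a , false) (b , false) (c , true) (d , true)
        (trans (tally-cong (λ (S , P) → ♯-cong (_ ≟₂ _) (_ ≟ _)
                   (link⇒act C P false ∘ cong proj₁) (cong (_, true) ∘ act⇒link C P false)) systems)
               (tally-zip₂ (λ P → ♯ (act P false (colour C a b) ≟ colour C c d)) pure perms systems-length))
        refl)
      (trans (ℕ.+-comm (tally _ perms) (tally _ cross))
             (mixed-count (ab ∘ cong (_, false)) (cd ∘ cong (_, true))))

  -- The count is invariant under the adjacent transpositions of the four points, the last one by
  -- involutivity, so every split reduces to 4 + 0, 3 + 1 or 2 + 2.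
  pure₂-count : ∀ {x y z w} → Distinct₄ x y z w → blocks x y z w ≡ μ
  pure₂-count {x} {y} {z} {w} = go x y z w
    where
    via₁₂ : ∀ x y z w → (Distinct₄ y x z w → blocks y x z w ≡ μ) → Distinct₄ x y z w → blocks x y z w ≡ μ
    via₁₂ x y z w f D = trans (blocks₁₂ x y z w) (f (swap₁₂ D))

    via₂₃ : ∀ x y z w → (Distinct₄ x z y w → blocks x z y w ≡ μ) → Distinct₄ x y z w → blocks x y z w ≡ μ
    via₂₃ x y z w f D = trans (blocks₂₃ x y z w) (f (swap₂₃ D))

    via₃₄ : ∀ x y z w → (Distinct₄ x y w z → blocks x y w z ≡ μ) → Distinct₄ x y z w → blocks x y z w ≡ μ
    via₃₄ x y z w f D = trans (blocks₃₄ x y z w) (f (swap₃₄ D))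

    go : ∀ x y z w → Distinct₄ x y z w → blocks x y z w ≡ μ
    go (a , false) (b , false) (c , false) (d , false) = within-half false
    go (a , true)  (b , true)  (c , true)  (d , true)  = within-half true
    go (a , false) (b , false) (c , false) (d , true)  = three-one false
    go (a , true)  (b , true)  (c , true)  (d , false) = three-one true
    go x@(a , false) y@(b , false) z@(c , true)  w@(d , false) = via₃₄ x y z w (three-one false)
    go x@(a , true)  y@(b , true)  z@(c , false) w@(d , true)  = via₃₄ x y z w (three-one true)
    go x@(a , false) y@(b , true)  z@(c , false) w@(d , false) = via₂₃ x y z w (via₃₄ x z y w (three-one false))
    go x@(a , true)  y@(b , false) z@(c , true)  w@(d , true)  = via₂₃ x y z w (via₃₄ x z y w (three-one true))
    go x@(a , true)  y@(b , false) z@(c , false) w@(d , false) =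
      via₁₂ x y z w (via₂₃ y x z w (via₃₄ y z x w (three-one false)))
    go x@(a , false) y@(b , true)  z@(c , true)  w@(d , true)  =
      via₁₂ x y z w (via₂₃ y x z w (via₃₄ y z x w (three-one true)))
    go (a , false) (b , false) (c , true) (d , true) = two-two
    go x@(a , false) y@(b , true)  z@(c , false) w@(d , true)  = via₂₃ x y z w two-two
    go x@(a , false) y@(b , true)  z@(c , true)  w@(d , false) = via₃₄ x y z w (via₂₃ x y w z two-two)
    go x@(a , true)  y@(b , false) z@(c , false) w@(d , true)  = via₁₂ x y z w (via₂₃ y x z w two-two)
    go x@(a , true)  y@(b , false) z@(c , true)  w@(d , false) =
      via₁₂ x y z w (via₃₄ y x z w (via₂₃ y x w z two-two))
    go x@(a , true)  y@(b , true)  z@(c , false) w@(d , false) =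
      via₂₃ x y z w (via₁₂ x z y w (via₃₄ z x y w (via₂₃ z x w y two-two)))

  next : Stage μ G₂
  next = record
    { colouring    = C₂
    ; e₀           = e₀ , false
    ; e₁           = e₁ , false
    ; e₂           = e₂ , false
    ; rest         = rest₂
    ; enum-once    = enum₂-once
    ; pure         = pure₂
    ; perms        = perms₂
    ; cross        = cross₂
    ; pure-length  = pure₂-length
    ; perms-length = perms₂-length
    ; cross-length = cross₂-length
    ; pure-count   = pure₂-count
    ; cross-count  = cross₂-count
    ; mixed-count  = λ {(a , i)} {(b , j)} {(c , k)} {(d , l)} → mixed₂-count i j k l
    }

-- Systems of subsets and skeins

∣⁅x⁆∪p∣ : (x : Fin n) (p : Subset n) → x ∉ p → ∣ ⁅ x ⁆ ∪ p ∣ ≡ suc ∣ p ∣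
∣⁅x⁆∪p∣ zero    (inside  ∷ p) x∉p = contradiction Vec.here x∉p
∣⁅x⁆∪p∣ zero    (outside ∷ p) x∉p = cong (suc ∘ ∣_∣) (∪-identityˡ p)
∣⁅x⁆∪p∣ (suc x) (inside  ∷ p) x∉p = cong suc (∣⁅x⁆∪p∣ x p (x∉p ∘ Vec.there))
∣⁅x⁆∪p∣ (suc x) (outside ∷ p) x∉p = ∣⁅x⁆∪p∣ x p (x∉p ∘ Vec.there)

⊆∧∣≡∣⇒≡ : {p q : Subset n} → p ⊆ q → ∣ p ∣ ≡ ∣ q ∣ → p ≡ q
⊆∧∣≡∣⇒≡ {p = []}          {[]}          p⊆q eq = refl
⊆∧∣≡∣⇒≡ {p = inside  ∷ p} {inside  ∷ q} p⊆q eq = cong (inside ∷_) (⊆∧∣≡∣⇒≡ (drop-∷-⊆ p⊆q) (ℕ.suc-injective eq))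
⊆∧∣≡∣⇒≡ {p = outside ∷ p} {outside ∷ q} p⊆q eq = cong (outside ∷_) (⊆∧∣≡∣⇒≡ (drop-∷-⊆ p⊆q) eq)
⊆∧∣≡∣⇒≡ {p = outside ∷ p} {inside  ∷ q} p⊆q eq =
  contradiction (p⊆q⇒∣p∣≤∣q∣ (drop-∷-⊆ p⊆q)) (ℕ.<⇒≱ (ℕ.≤-reflexive (sym eq)))
⊆∧∣≡∣⇒≡ {p = inside  ∷ p} {outside ∷ q} p⊆q eq with p⊆q Vec.here
... | ()

∃∈∖ : (p q : Subset n) → ∣ p ∣ < ∣ q ∣ → ∃ λ x → x ∈ q × x ∉ p
∃∈∖ p q p<q with Fin.any? (λ x → (x ∈? q) ×-dec ¬? (x ∈? p))
... | yes x = x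
... | no ¬x = contradiction (p⊆q⇒∣p∣≤∣q∣ q⊆p) (ℕ.<⇒≱ p<q)
  where
  q⊆p : q ⊆ p
  q⊆p {x} x∈q with x ∈? p
  ... | yes x∈p = x∈p
  ... | no  x∉p = contradiction (x , x∈q , x∉p) ¬x

∣∣≡suc⇒ : ∀ {k} (p : Subset n) → ∣ p ∣ ≡ suc k → ∃ λ x → ∃ λ q → x ∉ q × p ≡ ⁅ x ⁆ ∪ q × ∣ q ∣ ≡ k
∣∣≡suc⇒ (inside ∷ p) eq =
  zero , outside ∷ p , (λ ()) , cong (inside ∷_) (sym (∪-identityˡ p)) , ℕ.suc-injective eq
∣∣≡suc⇒ (outside ∷ p) eq with ∣∣≡suc⇒ p eq
... | x , q , x∉q , refl , eq′ = suc x , outside ∷ q , x∉q ∘ drop-there , refl , eq′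

∣∣≡0⇒∅ : (p : Subset n) → ∣ p ∣ ≡ 0 → p ≡ ∅
∣∣≡0⇒∅ {n} p eq = sym (⊆∧∣≡∣⇒≡ (⊥-elim ∘ ∉⊥) (trans (∣⊥∣≡0 n) (sym eq)))

-- The trailing `∅` makes pairs, triples and quadruples all arise by inserting points, so `∣⁅x⁆∪p∣`
-- gives every size and `⁅⁆∪-swap` every reordering.
⟦_·_⟧ : (a b : Fin n) → Subset n
⟦ a · b ⟧ = ⁅ a ⁆ ∪ (⁅ b ⁆ ∪ ∅)

⟦_·_·_⟧ : (a b c : Fin n) → Subset n
⟦ a · b · c ⟧ = ⁅ a ⁆ ∪ ⟦ b · c ⟧

⟦_·_·_·_⟧ : (a b c d : Fin n) → Subset n
⟦ a · b · c · d ⟧ = ⁅ a ⁆ ∪ ⟦ b · c · d ⟧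

module _ {n : ℕ} where

  private
    variable
      a b c d x : Fin n
      p         : Subset n

  x∈⁅x⁆∪p : x ∈ ⁅ x ⁆ ∪ p
  x∈⁅x⁆∪p = x∈p∪q⁺ (inj₁ (x∈⁅x⁆ _))

  ∈-skip : x ∈ p → x ∈ ⁅ a ⁆ ∪ p
  ∈-skip x∈p = x∈p∪q⁺ (inj₂ x∈p)

  ∈-case : x ∈ ⁅ a ⁆ ∪ p → x ≡ a ⊎ x ∈ p
  ∈-case {a = a} {p = p} x∈ with x∈p∪q⁻ ⁅ a ⁆ p x∈
  ... | inj₁ x∈⁅a⁆ = inj₁ (x∈⁅y⁆⇒x≡y a x∈⁅a⁆)
  ... | inj₂ x∈p   = inj₂ x∈p

  ∈₂⇒ : x ∈ ⟦ a · b ⟧ → x ≡ a ⊎ x ≡ b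
  ∈₂⇒ x∈ with ∈-case x∈
  ... | inj₁ eq = inj₁ eq
  ... | inj₂ x∈ with ∈-case x∈
  ...   | inj₁ eq = inj₂ eq
  ...   | inj₂ x∈ = ⊥-elim (∉⊥ x∈)

  ∈₃⇒ : x ∈ ⟦ a · b · c ⟧ → x ≡ a ⊎ x ≡ b ⊎ x ≡ c
  ∈₃⇒ x∈ with ∈-case x∈
  ... | inj₁ eq = inj₁ eq
  ... | inj₂ x∈ = inj₂ (∈₂⇒ x∈)

  ∈₄⇒ : x ∈ ⟦ a · b · c · d ⟧ → x ≡ a ⊎ x ≡ b ⊎ x ≡ c ⊎ x ≡ d
  ∈₄⇒ x∈ with ∈-case x∈
  ... | inj₁ eq = inj₁ eq
  ... | inj₂ x∈ = inj₂ (∈₃⇒ x∈)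

  ⁅⁆∪-swap : ∀ a b (p : Subset n) → ⁅ a ⁆ ∪ (⁅ b ⁆ ∪ p) ≡ ⁅ b ⁆ ∪ (⁅ a ⁆ ∪ p)
  ⁅⁆∪-swap a b p = trans (sym (∪-assoc ⁅ a ⁆ ⁅ b ⁆ p)) (trans (cong (_∪ p) (∪-comm ⁅ a ⁆ ⁅ b ⁆)) (∪-assoc ⁅ b ⁆ ⁅ a ⁆ p))

  ∣₂∣ : a ≢ b → ∣ ⟦ a · b ⟧ ∣ ≡ 2
  ∣₂∣ {a} {b} a≢b = trans
    (∣⁅x⁆∪p∣ a _ λ a∈ → case ∈-case a∈ of λ { (inj₁ eq) → a≢b eq ; (inj₂ a∈∅) → ∉⊥ a∈∅ })
    (cong suc (trans (∣⁅x⁆∪p∣ b ∅ ∉⊥) (cong suc (∣⊥∣≡0 n))))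

  ∣₃∣ : Distinct₃ a b c → ∣ ⟦ a · b · c ⟧ ∣ ≡ 3
  ∣₃∣ {a} {b} {c} (a≢b , a≢c , b≢c) = trans
    (∣⁅x⁆∪p∣ a ⟦ b · c ⟧ λ a∈ → case ∈₂⇒ a∈ of λ { (inj₁ eq) → a≢b eq ; (inj₂ eq) → a≢c eq })
    (cong suc (∣₂∣ b≢c))

  ∣₄∣ : Distinct₄ a b c d → ∣ ⟦ a · b · c · d ⟧ ∣ ≡ 4
  ∣₄∣ {a} {b} {c} {d} ((a≢b , a≢c , b≢c) , a≢d , b≢d , c≢d) = trans
    (∣⁅x⁆∪p∣ a ⟦ b · c · d ⟧ λ a∈ → case ∈₃⇒ a∈ of λ
      { (inj₁ eq) → a≢b eq ; (inj₂ (inj₁ eq)) → a≢c eq ; (inj₂ (inj₂ eq)) → a≢d eq })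
    (cong suc (∣₃∣ (b≢c , b≢d , c≢d)))

  ∣∣≡2⇒ : (p : Subset n) → ∣ p ∣ ≡ 2 → ∃ λ a → ∃ λ b → a ≢ b × p ≡ ⟦ a · b ⟧
  ∣∣≡2⇒ p eq with ∣∣≡suc⇒ p eq
  ... | a , q , a∉q , refl , eq₁ with ∣∣≡suc⇒ q eq₁
  ... | b , r , b∉r , refl , eq₀ rewrite ∣∣≡0⇒∅ r eq₀ =
    a , b , (λ { refl → a∉q x∈⁅x⁆∪p }) , refl

  ∣∣≡3⇒ : (p : Subset n) → ∣ p ∣ ≡ 3 → ∃ λ a → ∃ λ b → ∃ λ c → Distinct₃ a b c × p ≡ ⟦ a · b · c ⟧
  ∣∣≡3⇒ p eq with ∣∣≡suc⇒ p eq
  ... | a , q , a∉q , refl , eq₂ with ∣∣≡2⇒ q eq₂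
  ... | b , c , b≢c , refl =
    a , b , c , ((λ { refl → a∉q x∈⁅x⁆∪p }) , (λ { refl → a∉q (∈-skip x∈⁅x⁆∪p) }) , b≢c) , refl

  ∣∣≡4⇒ : (p : Subset n) → ∣ p ∣ ≡ 4 →
          ∃ λ a → ∃ λ b → ∃ λ c → ∃ λ d → Distinct₄ a b c d × p ≡ ⟦ a · b · c · d ⟧
  ∣∣≡4⇒ p eq with ∣∣≡suc⇒ p eq
  ... | a , q , a∉q , refl , eq₃ with ∣∣≡3⇒ q eq₃
  ... | b , c , d , (b≢c , b≢d , c≢d) , refl =
    a , b , c , d
    , (((λ { refl → a∉q x∈⁅x⁆∪p }) , (λ { refl → a∉q (∈-skip x∈⁅x⁆∪p) }) , b≢c)
      , (λ { refl → a∉q (∈-skip (∈-skip x∈⁅x⁆∪p)) }) , b≢d , c≢d)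
    , refl

module FromSkein {n : ℕ} (S : Skein (Fin n)) where

  blockThrough : (a b c : Fin n) → Subset n
  blockThrough a b c = ⟦ a · b · c · op S a b c ⟧

  distinct₄ : ∀ {a b c} → Distinct₃ a b c → Distinct₄ a b c (op S a b c)
  distinct₄ D@(a≢b , a≢c , b≢c) =
    D , op≢₁ S a≢b a≢c b≢c ∘ sym , op≢₂ S a≢b a≢c b≢c ∘ sym , op≢₃ S a≢b a≢c b≢c ∘ sym

  through₁₂ : ∀ a b c → blockThrough a b c ≡ blockThrough b a c
  through₁₂ a b c rewrite comm₁₂ S a b c = ⁅⁆∪-swap a b _

  through₂₃ : ∀ a b c → blockThrough a b c ≡ blockThrough a c b
  through₂₃ a b c rewrite comm₂₃ S a b c = cong (⁅ a ⁆ ∪_) (⁅⁆∪-swap b c _)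

  through₃₄ : ∀ a b c → blockThrough a b c ≡ blockThrough a b (op S a b c)
  through₃₄ a b c rewrite invol S a b c = cong (λ p → ⁅ a ⁆ ∪ (⁅ b ⁆ ∪ p)) (⁅⁆∪-swap c _ ∅)

  -- The point `x` is `c` or the fourth point, and by `invol` the fourth point leads back to `c`.
  rebase₃ : ∀ {a b c x} → x ∈ blockThrough a b c → x ≢ a → x ≢ b →
            blockThrough a b c ≡ blockThrough a b x
  rebase₃ {a} {b} {c} x∈ x≢a x≢b with ∈₄⇒ x∈
  ... | inj₁ eq                 = contradiction eq x≢a
  ... | inj₂ (inj₁ eq)          = contradiction eq x≢b
  ... | inj₂ (inj₂ (inj₁ refl)) = refl
  ... | inj₂ (inj₂ (inj₂ refl)) = through₃₄ a b c

  rebase₂ : ∀ {a b c x} → x ∈ blockThrough a b c → x ≢ a →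
            ∃ λ y → blockThrough a b c ≡ blockThrough a x y
  rebase₂ {a} {b} {c} {x} x∈ x≢a with x Fin.≟ b
  ... | yes refl = c , refl
  ... | no  x≢b  = b , trans (rebase₃ x∈ x≢a x≢b) (through₂₃ a b x)

  rebase₁ : ∀ {a b c x} → x ∈ blockThrough a b c →
            ∃ λ y → ∃ λ z → blockThrough a b c ≡ blockThrough x y z
  rebase₁ {a} {b} {c} {x} x∈ with x Fin.≟ a
  ... | yes refl = b , c , refl
  ... | no  x≢a  with rebase₂ x∈ x≢a
  ...   | y , eq = a , y , trans eq (through₁₂ a x y)

  -- The three points are brought to the front one at a time, by `rebase₁`, `rebase₂` and `rebase₃`;
  -- distinctness keeps those already placed from being displaced.
  determined : ∀ {a b c x y z} → Distinct₃ x y z → x ∈ blockThrough a b c → y ∈ blockThrough a b c →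
               z ∈ blockThrough a b c → blockThrough a b c ≡ blockThrough x y z
  determined (x≢y , x≢z , y≢z) x∈ y∈ z∈ with rebase₁ x∈
  ... | _ , _ , eq₁ with rebase₂ (subst (_ ∈_) eq₁ y∈) (x≢y ∘ sym)
  ... | _ , eq₂ = trans eq (rebase₃ (subst (_ ∈_) eq z∈) (x≢z ∘ sym) (y≢z ∘ sym))
    where eq = trans eq₁ eq₂

  IsBlock : Subset n → Set
  IsBlock B = ∃ λ a → ∃ λ b → ∃ λ c → Distinct₃ a b c × B ≡ blockThrough a b c

  isBlock? : ∀ B → Dec (IsBlock B)
  isBlock? B = Fin.any? λ a → Fin.any? λ b → Fin.any? λ c →
    (¬? (a Fin.≟ b) ×-dec ¬? (a Fin.≟ c) ×-dec ¬? (b Fin.≟ c)) ×-dec (B ≟ˢ blockThrough a b c)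

  -- By `determined` the block is the one through `a`, `b`, `c`, so it contains their fourth point,
  -- which is none of these three.
  isBlock⇒op : ∀ {a b c d} → Distinct₄ a b c d → IsBlock ⟦ a · b · c · d ⟧ → op S a b c ≡ d
  isBlock⇒op {a} {b} {c} {d} (D@(a≢b , a≢c , b≢c) , _) (_ , _ , _ , _ , eq) =
    fourth (∈₄⇒ (subst (op S a b c ∈_) (sym (trans eq same)) (∈-skip (∈-skip (∈-skip x∈⁅x⁆∪p)))))
    where
    same : _ ≡ blockThrough a b c
    same = determined D (subst (a ∈_) eq x∈⁅x⁆∪p) (subst (b ∈_) eq (∈-skip x∈⁅x⁆∪p))
                        (subst (c ∈_) eq (∈-skip (∈-skip x∈⁅x⁆∪p)))

    fourth : op S a b c ≡ a ⊎ op S a b c ≡ b ⊎ op S a b c ≡ c ⊎ op S a b c ≡ d → op S a b c ≡ d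
    fourth (inj₁ eq)               = contradiction eq (op≢₁ S a≢b a≢c b≢c)
    fourth (inj₂ (inj₁ eq))        = contradiction eq (op≢₂ S a≢b a≢c b≢c)
    fourth (inj₂ (inj₂ (inj₁ eq))) = contradiction eq (op≢₃ S a≢b a≢c b≢c)
    fourth (inj₂ (inj₂ (inj₂ eq))) = eq

  op⇒isBlock : ∀ {a b c d} → Distinct₄ a b c d → op S a b c ≡ d → IsBlock ⟦ a · b · c · d ⟧
  op⇒isBlock {a} {b} {c} (D , _) refl = a , b , c , D , refl

  steinerSystem : SteinerSystem 3 4 n
  steinerSystem = record
    { Block   = IsBlock
    ; block?  = isBlock?
    ; uniform = λ { _ (_ , _ , _ , D , refl) → ∣₄∣ (distinct₄ D) }
    ; covers  = cover
    }
    where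
    cover : ∀ T → ∣ T ∣ ≡ 3 → ∃! _≡_ λ B → IsBlock B × T ⊆ B
    cover T eq with ∣∣≡3⇒ T eq
    ... | a , b , c , D , refl = blockThrough a b c , ((a , b , c , D , refl) , T⊆) , unique
      where
      T⊆ : ⟦ a · b · c ⟧ ⊆ blockThrough a b c
      T⊆ x∈ with ∈₃⇒ x∈
      ... | inj₁ refl        = x∈⁅x⁆∪p
      ... | inj₂ (inj₁ refl) = ∈-skip x∈⁅x⁆∪p
      ... | inj₂ (inj₂ refl) = ∈-skip (∈-skip x∈⁅x⁆∪p)

      unique : ∀ {B} → IsBlock B × ⟦ a · b · c ⟧ ⊆ B → blockThrough a b c ≡ B
      unique ((_ , _ , _ , _ , refl) , T⊆B) =
        sym (determined D (T⊆B x∈⁅x⁆∪p) (T⊆B (∈-skip x∈⁅x⁆∪p)) (T⊆B (∈-skip (∈-skip x∈⁅x⁆∪p))))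

module ToSkein {n : ℕ} (S : SteinerSystem 3 4 n) where

  -- The graph of the operation, with the degenerate triples included. As a relation it is visibly
  -- symmetric in all four points, and the laws of a skein follow from this symmetry together with
  -- uniqueness.
  data Completes (a b c d : Fin n) : Set where
    eq₁₂  : a ≡ b → c ≡ d → Completes a b c d
    eq₁₃  : a ≡ c → b ≡ d → Completes a b c d
    eq₂₃  : b ≡ c → a ≡ d → Completes a b c d
    block : Distinct₄ a b c d → Block S ⟦ a · b · c · d ⟧ → Completes a b c d

  completes₁₂ : ∀ {a b c d} → Completes a b c d → Completes b a c d
  completes₁₂ (eq₁₂ p q)  = eq₁₂ (sym p) q
  completes₁₂ (eq₁₃ p q)  = eq₂₃ p q
  completes₁₂ (eq₂₃ p q)  = eq₁₃ p q
  completes₁₂ (block D B) = block (swap₁₂ D) (subst (Block S) (⁅⁆∪-swap _ _ _) B)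

  completes₂₃ : ∀ {a b c d} → Completes a b c d → Completes a c b d
  completes₂₃ (eq₁₂ p q)  = eq₁₃ p q
  completes₂₃ (eq₁₃ p q)  = eq₁₂ p q
  completes₂₃ (eq₂₃ p q)  = eq₂₃ (sym p) q
  completes₂₃ (block D B) = block (swap₂₃ D) (subst (Block S) (cong (⁅ _ ⁆ ∪_) (⁅⁆∪-swap _ _ _)) B)

  completes₃₄ : ∀ {a b c d} → Completes a b c d → Completes a b d c
  completes₃₄ (eq₁₂ p q)  = eq₁₂ p (sym q)
  completes₃₄ (eq₁₃ p q)  = eq₂₃ q p
  completes₃₄ (eq₂₃ p q)  = eq₁₃ q p
  completes₃₄ (block D B) =
    block (swap₃₄ D) (subst (Block S) (cong (λ p → ⁅ _ ⁆ ∪ (⁅ _ ⁆ ∪ p)) (⁅⁆∪-swap _ _ _)) B)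

  ⟦₃⟧⊆⟦₄⟧ : ∀ {a b c d : Fin n} → ⟦ a · b · c ⟧ ⊆ ⟦ a · b · c · d ⟧
  ⟦₃⟧⊆⟦₄⟧ x∈ with ∈₃⇒ x∈
  ... | inj₁ refl        = x∈⁅x⁆∪p
  ... | inj₂ (inj₁ refl) = ∈-skip x∈⁅x⁆∪p
  ... | inj₂ (inj₂ refl) = ∈-skip (∈-skip x∈⁅x⁆∪p)

  -- Two different degenerate cases can only meet when `a`, `b`, `c` coincide. A distinct triple
  -- lies in one block only, so `d` is among `a`, `b`, `c`, `e` and differs from the first three.
  completes-unique : ∀ {a b c d e} → Completes a b c d → Completes a b c e → d ≡ e
  completes-unique (eq₁₂ refl refl) (eq₁₂ _ q)       = q
  completes-unique (eq₁₂ refl refl) (eq₁₃ refl refl) = refl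
  completes-unique (eq₁₂ refl refl) (eq₂₃ refl refl) = refl
  completes-unique (eq₁₃ refl refl) (eq₁₂ refl refl) = refl
  completes-unique (eq₁₃ refl refl) (eq₁₃ _ q)       = q
  completes-unique (eq₁₃ refl refl) (eq₂₃ refl refl) = refl
  completes-unique (eq₂₃ refl refl) (eq₁₂ refl refl) = refl
  completes-unique (eq₂₃ refl refl) (eq₁₃ refl refl) = refl
  completes-unique (eq₂₃ refl refl) (eq₂₃ _ q)       = q
  completes-unique (eq₁₂ p _) (block ((a≢b , _) , _) _) = contradiction p a≢b
  completes-unique (eq₁₃ p _) (block ((_ , a≢c , _) , _) _) = contradiction p a≢c
  completes-unique (eq₂₃ p _) (block ((_ , _ , b≢c) , _) _) = contradiction p b≢c
  completes-unique (block ((a≢b , _) , _) _) (eq₁₂ p _) = contradiction p a≢b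
  completes-unique (block ((_ , a≢c , _) , _) _) (eq₁₃ p _) = contradiction p a≢c
  completes-unique (block ((_ , _ , b≢c) , _) _) (eq₂₃ p _) = contradiction p b≢c
  completes-unique {a} {b} {c} {d} {e} (block (D , a≢d , b≢d , c≢d) B) (block _ B′)
    with SteinerSystem.covers S ⟦ a · b · c ⟧ (∣₃∣ D)
  ... | _ , _ , unique
    with ∈₄⇒ (subst (d ∈_) (trans (sym (unique (B , ⟦₃⟧⊆⟦₄⟧))) (unique (B′ , ⟦₃⟧⊆⟦₄⟧)))
                    (∈-skip (∈-skip (∈-skip x∈⁅x⁆∪p))))
  ...   | inj₁ eq               = contradiction (sym eq) a≢d
  ...   | inj₂ (inj₁ eq)        = contradiction (sym eq) b≢d
  ...   | inj₂ (inj₂ (inj₁ eq)) = contradiction (sym eq) c≢d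
  ...   | inj₂ (inj₂ (inj₂ eq)) = eq

  complete : ∀ a b c → ∃ (Completes a b c)
  complete a b c with a Fin.≟ b | a Fin.≟ c | b Fin.≟ c
  ... | yes p | _     | _     = c , eq₁₂ p refl
  ... | no _  | yes p | _     = b , eq₁₃ p refl
  ... | no _  | no _  | yes p = a , eq₂₃ p refl
  ... | no a≢b | no a≢c | no b≢c with SteinerSystem.covers S ⟦ a · b · c ⟧ (∣₃∣ (a≢b , a≢c , b≢c))
  ... | B , (isB , T⊆B) , _
    -- The block has four points and the triple three, so some point of the block is left over.
    with ∃∈∖ ⟦ a · b · c ⟧ B (ℕ.≤-reflexive (trans (cong suc (∣₃∣ (a≢b , a≢c , b≢c)))
                                                   (sym (SteinerSystem.uniform S B isB))))
  ... | d , d∈B , d∉T = d , block D (subst (Block S) (sym eq) isB)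
    where
    D : Distinct₄ a b c d
    D = (a≢b , a≢c , b≢c) , (λ { refl → d∉T x∈⁅x⁆∪p })
      , (λ { refl → d∉T (∈-skip x∈⁅x⁆∪p) }) , λ { refl → d∉T (∈-skip (∈-skip x∈⁅x⁆∪p)) }

    ⊆B : ⟦ a · b · c · d ⟧ ⊆ B
    ⊆B x∈ with ∈₄⇒ x∈
    ... | inj₁ refl               = T⊆B x∈⁅x⁆∪p
    ... | inj₂ (inj₁ refl)        = T⊆B (∈-skip x∈⁅x⁆∪p)
    ... | inj₂ (inj₂ (inj₁ refl)) = T⊆B (∈-skip (∈-skip x∈⁅x⁆∪p))
    ... | inj₂ (inj₂ (inj₂ refl)) = d∈B

    eq : ⟦ a · b · c · d ⟧ ≡ B
    eq = ⊆∧∣≡∣⇒≡ ⊆B (trans (∣₄∣ D) (sym (SteinerSystem.uniform S B isB)))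

  toSkein : Skein (Fin n)
  toSkein = record
    { op     = λ a b c → proj₁ (complete a b c)
    ; comm₁₂ = λ a b c → completes-unique (proj₂ (complete a b c)) (completes₁₂ (proj₂ (complete b a c)))
    ; comm₂₃ = λ a b c → completes-unique (proj₂ (complete a b c)) (completes₂₃ (proj₂ (complete a c b)))
    ; cancel = λ a b → completes-unique (proj₂ (complete a a b)) (eq₁₂ refl refl)
    ; invol  = λ a b c → completes-unique (proj₂ (complete a b _)) (completes₃₄ (proj₂ (complete a b c)))
    }

  block⇒op : ∀ {a b c d} → Distinct₄ a b c d → Block S ⟦ a · b · c · d ⟧ → op toSkein a b c ≡ d
  block⇒op {a} {b} {c} D B = completes-unique (proj₂ (complete a b c)) (block D B)

  op⇒block : ∀ {a b c d} → Distinct₄ a b c d → op toSkein a b c ≡ d → Block S ⟦ a · b · c · d ⟧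
  op⇒block {a} {b} {c} ((a≢b , a≢c , b≢c) , _) refl with proj₂ (complete a b c)
  ... | eq₁₂ p _  = contradiction p a≢b
  ... | eq₁₃ p _  = contradiction p a≢c
  ... | eq₂₃ p _  = contradiction p b≢c
  ... | block _ B = B

-- The initial stage

tally-const : ∀ m (xs : List A) → tally (λ _ → m) xs ≡ length xs * m
tally-const m []       = refl
tally-const m (x ∷ xs) = cong (m +_) (tally-const m xs)

tally-swap : (h : A → B → ℕ) → ∀ xs ys →
             tally (λ x → tally (h x) ys) xs ≡ tally (λ y → tally (λ x → h x y) xs) ys
tally-swap h []       ys = sym (tally-zero (λ _ → refl) ys)
tally-swap h (x ∷ xs) ys = trans (cong (tally (h x) ys +_) (tally-swap h xs ys))
                                 (sym (tally-+ (h x) (λ y → tally (λ x → h x y) xs) ys))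

-- Each member has exactly one value among `ys`. This finds the length of a family from its counts
-- for the single values.
length-by-value : (_≟_ : DecidableEquality B) (h : A → B) → ∀ ys →
                  (∀ z → tally (λ y → ♯ (z ≟ y)) ys ≡ 1) → ∀ xs →
                  length xs ≡ tally (λ y → tally (λ x → ♯ (h x ≟ y)) xs) ys
length-by-value _≟_ h ys once xs = begin
  length xs                                      ≡⟨ ℕ.*-identityʳ (length xs) ⟨
  length xs * 1                                  ≡⟨ tally-const 1 xs ⟨
  tally (λ _ → 1) xs                             ≡⟨ tally-cong (λ x → sym (once (h x))) xs ⟩
  tally (λ x → tally (λ y → ♯ (h x ≟ y)) ys) xs  ≡⟨ tally-swap (λ x y → ♯ (h x ≟ y)) xs ys ⟩
  tally (λ y → tally (λ x → ♯ (h x ≟ y)) xs) ys  ∎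
  where open ≡-Reasoning

tally-tabulate : (h : A → ℕ) (f : Fin n → A) → tally h (tabulate f) ≡ tally (h ∘ f) (allFin n)
tally-tabulate {n = n} h f =
  trans (cong (tally h) (sym (map-tabulate (λ i → i) f))) (tally-map h f (allFin n))

allFin-once : (i : Fin n) → tally (λ j → ♯ (i Fin.≟ j)) (allFin n) ≡ 1
allFin-once {suc n} zero = cong suc (trans (tally-tabulate {n = n} (λ j → ♯ (zero Fin.≟ j)) suc)
                                           (tally-zero (λ j → ♯-no (zero Fin.≟ suc j) λ ()) (allFin n)))
allFin-once {suc n} (suc i) = trans (tally-tabulate {n = n} (λ j → ♯ (suc i Fin.≟ j)) suc)
  (trans (tally-cong (λ j → ♯-cong (suc i Fin.≟ suc j) (i Fin.≟ j) Fin.suc-injective (cong suc)) (allFin n))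
         (allFin-once i))

-- The cyclic group, and cyclic shifts of the colours

module _ (m : ℕ) where
  private N = suc m

  toℕ-mod : ∀ k → toℕ (k mod N) ≡ k % N
  toℕ-mod k = Fin.toℕ-fromℕ< (m%n<n k N)

  toℕ-% : (i : Fin N) → toℕ i % N ≡ toℕ i
  toℕ-% i = m<n⇒m%n≡m (Fin.toℕ<n i)

  %-absorbˡ : ∀ a b → (a % N + b) % N ≡ (a + b) % N
  %-absorbˡ a b = begin
    (a % N + b) % N         ≡⟨ %-distribˡ-+ (a % N) b N ⟩
    (a % N % N + b % N) % N ≡⟨ cong (λ r → (r + b % N) % N) (m%n%n≡m%n a N) ⟩
    (a % N + b % N) % N     ≡⟨ %-distribˡ-+ a b N ⟨
    (a + b) % N             ∎
    where open ≡-Reasoning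

  add : Fin N → Fin N → Fin N
  add i j = (toℕ i + toℕ j) mod N

  neg : Fin N → Fin N
  neg i = (N ∸ toℕ i) mod N

  add-comm : ∀ i j → add i j ≡ add j i
  add-comm i j = cong (_mod N) (ℕ.+-comm (toℕ i) (toℕ j))

  toℕ-add₃ : ∀ i j k → toℕ (add (add i j) k) ≡ (toℕ i + toℕ j + toℕ k) % N
  toℕ-add₃ i j k = begin
    toℕ (add (add i j) k)             ≡⟨ toℕ-mod (toℕ (add i j) + toℕ k) ⟩
    (toℕ (add i j) + toℕ k) % N       ≡⟨ cong (λ r → (r + toℕ k) % N) (toℕ-mod (toℕ i + toℕ j)) ⟩
    ((toℕ i + toℕ j) % N + toℕ k) % N ≡⟨ %-absorbˡ (toℕ i + toℕ j) (toℕ k) ⟩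
    (toℕ i + toℕ j + toℕ k) % N       ∎
    where open ≡-Reasoning

  add-assoc : ∀ i j k → add (add i j) k ≡ add i (add j k)
  add-assoc i j k = Fin.toℕ-injective (begin
    toℕ (add (add i j) k)         ≡⟨ toℕ-add₃ i j k ⟩
    (toℕ i + toℕ j + toℕ k) % N   ≡⟨ cong (_% N) (trans (ℕ.+-assoc (toℕ i) _ _) (ℕ.+-comm (toℕ i) _)) ⟩
    (toℕ j + toℕ k + toℕ i) % N   ≡⟨ toℕ-add₃ j k i ⟨
    toℕ (add (add j k) i)         ≡⟨ cong toℕ (add-comm (add j k) i) ⟩
    toℕ (add i (add j k))         ∎)
    where open ≡-Reasoning

  add-identityˡ : ∀ i → add zero i ≡ i
  add-identityˡ i = Fin.toℕ-injective (trans (toℕ-mod (toℕ i)) (toℕ-% i))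

  add-inverseˡ : ∀ i → add (neg i) i ≡ zero
  add-inverseˡ i = Fin.toℕ-injective (begin
    toℕ (add (neg i) i)               ≡⟨ toℕ-mod (toℕ (neg i) + toℕ i) ⟩
    (toℕ (neg i) + toℕ i) % N         ≡⟨ cong (λ r → (r + toℕ i) % N) (toℕ-mod (N ∸ toℕ i)) ⟩
    ((N ∸ toℕ i) % N + toℕ i) % N     ≡⟨ %-absorbˡ (N ∸ toℕ i) (toℕ i) ⟩
    (N ∸ toℕ i + toℕ i) % N           ≡⟨ cong (_% N) (ℕ.m∸n+n≡m (ℕ.<⇒≤ (Fin.toℕ<n i))) ⟩
    N % N                             ≡⟨ n%n≡0 N ⟩
    0                                 ∎)
    where open ≡-Reasoning

  cyclic : Points
  cyclic = record
    { Carrier = Fin N ; _≟_ = Fin._≟_ ; _∙_ = add ; ε = zero ; _⁻¹ = neg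
    ; isAbelianGroup = record
      { isGroup = record
        { isMonoid = record
          { isSemigroup = record
            { isMagma = record { isEquivalence = isEquivalence ; ∙-cong = cong₂ add }
            ; assoc   = add-assoc
            }
          ; identity = add-identityˡ , λ i → trans (add-comm i zero) (add-identityˡ i)
          }
        ; inverse = add-inverseˡ , λ i → trans (add-comm i (neg i)) (add-inverseˡ i)
        ; ⁻¹-cong = cong neg
        }
      ; comm = add-comm
      }
    }

module _ {m : ℕ} where
  open Points (cyclic m)

  -- The nonzero colours `suc k` are identified with a cyclic group of order one less than the
  -- number of points; this is not the group carried by the points.
  rotating : Fin (suc m) → Recolouring (Fin (suc (suc m))) zero
  rotating t = record { act = rotate ; act-inv = rotate-inv ; act-ε = λ _ → refl }
    where
    rotate : Bool → Fin (suc (suc m)) → Fin (suc (suc m))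
    rotate s     zero    = zero
    rotate false (suc k) = suc (k ∙ t)
    rotate true  (suc k) = suc (k ∙ t ⁻¹)

    rotate-inv : ∀ s k → rotate (not s) (rotate s k) ≡ k
    rotate-inv s     zero    = refl
    rotate-inv false (suc k) = cong suc (∙∙⁻¹ k t)
    rotate-inv true  (suc k) = cong suc (∙⁻¹∙ k t)

  -- The shifts act sharply transitively on the nonzero colours: only the difference of the two
  -- colours works.
  rotations-count : ∀ {k l} → k ≢ zero → l ≢ zero →
                    tally (λ t → ♯ (act (rotating t) false k Fin.≟ l)) (allFin (suc m)) ≡ 1
  rotations-count {zero}  {_}     k≢0 l≢0 = contradiction refl k≢0
  rotations-count {suc k} {zero}  k≢0 l≢0 = contradiction refl l≢0
  rotations-count {suc k} {suc l} k≢0 l≢0 = trans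
    (tally-cong (λ t → ♯-cong (suc (k ∙ t) Fin.≟ suc l) (l ∙ k ⁻¹ Fin.≟ t)
      (λ eq → sym (∙≡⇒≡∙⁻¹ (trans (comm t k) (Fin.suc-injective eq))))
      (λ { refl → cong suc (∙⁻¹-swap k l) })) (allFin (suc m)))
    (allFin-once (l ∙ k ⁻¹))

-- A crossing system from a permutation of the points

majority : Bool → Bool → Bool → Bool
majority false false k     = false
majority true  true  k     = true
majority false true  k     = k
majority true  false k     = k

module Odd (_≟_ : DecidableEquality A) (q : Bool → Skein A) where

  distinct? : ∀ a b c → Dec (Distinct₃ a b c)
  distinct? a b c = ¬? (a ≟ b) ×-dec ¬? (a ≟ c) ×-dec ¬? (b ≟ c)

  -- The correction to the parity: lifts of genuine blocks become odd, while degenerate triples stay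
  -- even and give the blocks of two full fibres.
  δ : (a b c : A) → Bool
  δ a b c = does (distinct? a b c)

  -- With a repeated point every skein returns the remaining one, so it is harmless that the
  -- majority, and with it the skein, may change at the second application.
  degenerate : ∀ {a b c} → ¬ Distinct₃ a b c → ∀ m m′ →
               op (q m′) a b (op (q m) a b c) ≡ c × ¬ Distinct₃ a b (op (q m) a b c)
  degenerate {a} {b} {c} ¬D m m′ with a ≟ b | a ≟ c | b ≟ c
  ... | yes refl | _ | _ = trans (cancel (q m′) a _) (cancel (q m) a c) , λ (a≢a , _) → a≢a refl
  ... | no _ | yes refl | _ rewrite cancel₁₃ (q m) a b = cancel₂₃ (q m′) a b , λ (_ , _ , b≢b) → b≢b refl
  ... | no _ | no _ | yes refl rewrite cancel₂₃ (q m) a b = cancel₁₃ (q m′) a b , λ (_ , a≢a , _) → a≢a refl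
  ... | no a≢b | no a≢c | no b≢c = contradiction (a≢b , a≢c , b≢c) ¬D

  oddOp : A × Bool → A × Bool → A × Bool → A × Bool
  oddOp (a , i) (b , j) (c , k) = op (q (majority i j k)) a b c , (i xor (j xor k)) xor δ a b c

  -- The blocks over {a, b, c, d} are its lifts of odd parity; those with three
  -- points in half i lie over blocks of q i.  The other blocks are {a, b} × Bool.
  odd : Skein (A × Bool)
  odd = record
    { op     = oddOp
    ; comm₁₂ = λ (a , i) (b , j) (c , k) → cong₂ _,_
        (trans (cong (λ m → op (q m) a b c) (maj₁₂ i j k)) (comm₁₂ (q _) a b c))
        (cong₂ _xor_ (par₁₂ i j k)
          (does-⇔ (mk⇔ (λ (p , r , s) → p ∘ sym , s , r) λ (p , r , s) → p ∘ sym , s , r)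
                  (distinct? a b c) (distinct? b a c)))
    ; comm₂₃ = λ (a , i) (b , j) (c , k) → cong₂ _,_
        (trans (cong (λ m → op (q m) a b c) (maj₂₃ i j k)) (comm₂₃ (q _) a b c))
        (cong₂ _xor_ (cong (i xor_) (xor-comm j k))
          (does-⇔ (mk⇔ (λ (p , r , s) → r , p , s ∘ sym) λ (p , r , s) → r , p , s ∘ sym)
                  (distinct? a b c) (distinct? a c b)))
    ; cancel = λ (a , i) (b , j) → cong₂ _,_ (cancel (q _) a b)
        (trans (cong ((i xor (i xor j)) xor_) (dec-false (distinct? a a b) λ (a≢a , _) → a≢a refl)) (par-cancel i j))
    ; invol  = odd-invol
    }
    where
    maj₁₂ : ∀ i j k → majority i j k ≡ majority j i k
    maj₁₂ false false k = refl
    maj₁₂ false true  k = refl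
    maj₁₂ true  false k = refl
    maj₁₂ true  true  k = refl

    maj₂₃ : ∀ i j k → majority i j k ≡ majority i k j
    maj₂₃ false false false = refl
    maj₂₃ false false true  = refl
    maj₂₃ false true  false = refl
    maj₂₃ false true  true  = refl
    maj₂₃ true  false false = refl
    maj₂₃ true  false true  = refl
    maj₂₃ true  true  false = refl
    maj₂₃ true  true  true  = refl

    par₁₂ : ∀ i j k → i xor (j xor k) ≡ j xor (i xor k)
    par₁₂ false false k = refl
    par₁₂ false true  k = refl
    par₁₂ true  false k = refl
    par₁₂ true  true  k = refl

    par-cancel : ∀ i j → (i xor (i xor j)) xor false ≡ j
    par-cancel false false = refl
    par-cancel false true  = refl
    par-cancel true  false = refl
    par-cancel true  true  = refl

    par-invol : ∀ δ i j k → (i xor (j xor ((i xor (j xor k)) xor δ))) xor δ ≡ k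
    par-invol false false false false = refl
    par-invol false false false true  = refl
    par-invol false false true  false = refl
    par-invol false false true  true  = refl
    par-invol false true  false false = refl
    par-invol false true  false true  = refl
    par-invol false true  true  false = refl
    par-invol false true  true  true  = refl
    par-invol true  false false false = refl
    par-invol true  false false true  = refl
    par-invol true  false true  false = refl
    par-invol true  false true  true  = refl
    par-invol true  true  false false = refl
    par-invol true  true  false true  = refl
    par-invol true  true  true  false = refl
    par-invol true  true  true  true  = refl

    -- Levels of odd parity split three to one, and any three of the four have the larger half as
    -- their majority; so the skein does not depend on which three points are given.
    maj-odd : ∀ i j k → majority i j ((i xor (j xor k)) xor true) ≡ majority i j k
    maj-odd false false k     = refl
    maj-odd true  true  k     = refl
    maj-odd false true  false = refl
    maj-odd false true  true  = refl
    maj-odd true  false false = refl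
    maj-odd true  false true  = refl

    with-δ : ∀ {s a b c} i j k → δ a b c ≡ s →
             oddOp (a , i) (b , j) (c , k) ≡ (op (q (majority i j k)) a b c , (i xor (j xor k)) xor s)
    with-δ i j k eq = cong (λ s → _ , (i xor (j xor k)) xor s) eq

    odd-invol : ∀ x y z → oddOp x y (oddOp x y z) ≡ z
    odd-invol (a , i) (b , j) (c , k) = case distinct? a b c of λ
      { (yes D@(a≢b , a≢c , b≢c)) → begin
          oddOp (a , i) (b , j) (oddOp (a , i) (b , j) (c , k))
            ≡⟨ cong (oddOp (a , i) (b , j)) (with-δ i j k (dec-true (distinct? a b c) D)) ⟩
          oddOp (a , i) (b , j) (d , (i xor (j xor k)) xor true)
            ≡⟨ with-δ i j ((i xor (j xor k)) xor true) (dec-true (distinct? a b d)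
                 (a≢b , op≢₁ (q m) a≢b a≢c b≢c ∘ sym , op≢₂ (q m) a≢b a≢c b≢c ∘ sym)) ⟩
          op (q (majority i j ((i xor (j xor k)) xor true))) a b d , _
            ≡⟨ cong₂ _,_ (trans (cong (λ m → op (q m) a b d) (maj-odd i j k)) (invol (q m) a b c))
                         (par-invol true i j k) ⟩
          (c , k) ∎
      ; (no ¬D) → begin
          oddOp (a , i) (b , j) (oddOp (a , i) (b , j) (c , k))
            ≡⟨ cong (oddOp (a , i) (b , j)) (with-δ i j k (dec-false (distinct? a b c) ¬D)) ⟩
          oddOp (a , i) (b , j) (d , (i xor (j xor k)) xor false)
            ≡⟨ with-δ i j ((i xor (j xor k)) xor false) (dec-false (distinct? a b d) (proj₂ (degenerate ¬D m m))) ⟩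
          op (q (majority i j ((i xor (j xor k)) xor false))) a b d , _
            ≡⟨ cong₂ _,_ (proj₁ (degenerate ¬D m _)) (par-invol false i j k) ⟩
          (c , k) ∎
      }
      where
      open ≡-Reasoning
      m = majority i j k
      d = op (q m) a b c

-- A missed value could be punched out of the codomain, leaving an injection into a set with one
-- point fewer.
injective⇒↔ : (f : Fin n → Fin n) → (∀ i j → f i ≡ f j → i ≡ j) → Fin n ↔ Fin n
injective⇒↔ {n} f inj = mk↔ₛ′ f (proj₁ ∘ preimage) (proj₂ ∘ preimage) λ x → inj _ x (proj₂ (preimage (f x)))
  where
  missing : ∀ {n} (f : Fin n → Fin n) → (∀ i j → f i ≡ f j → i ≡ j) → ∀ y → (∀ x → f x ≢ y) → ⊥
  missing {suc n} f inj y f≢y = ℕ.1+n≰n (Fin.injective⇒≤ {f = λ x → punchOut (f≢y x ∘ sym)}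
    λ {i} {j} eq → inj i j (Fin.punchOut-injective (f≢y i ∘ sym) (f≢y j ∘ sym) eq))

  preimage : ∀ y → ∃ λ x → f x ≡ y
  preimage y with Fin.any? (λ x → f x Fin.≟ y)
  ... | yes found = found
  ... | no  none  = ⊥-elim (missing f inj y λ x eq → none (x , eq))

MapsPair : {A : Set} (α : A ↔ A) (x y p q : A) → Set
MapsPair α x y p q = (to x ≡ p × to y ≡ q) ⊎ (to x ≡ q × to y ≡ p)
  where open Inverse α

module Relabelled (_≟_ : DecidableEquality A) (q : Skein A) (α : A ↔ A) where
  open Inverse α

  -- The second skein is chosen so that, once the second half is renamed by `α`, the three points of
  -- a block in either half are completed through `q` itself: the fourth point is the image of
  -- `op q a b c` under `α` or under its inverse.
  halves : Bool → Skein A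
  halves false = q
  halves true  = transport α q

  open Odd _≟_ halves

  relabel : (A × Bool) ↔ (A × Bool)
  relabel = mk↔ₛ′ (λ { (a , false) → a , false ; (p , true) → from p , true })
                  (λ { (a , false) → a , false ; (a , true) → to a , true })
                  (λ { (a , false) → refl ; (a , true) → cong (_, true) (strictlyInverseʳ a) })
                  (λ { (a , false) → refl ; (p , true) → cong (_, true) (strictlyInverseˡ p) })

  relabelled : Skein (A × Bool)
  relabelled = transport relabel odd

  from-injective : ∀ {x y} → from x ≡ from y → x ≡ y
  from-injective eq = trans (sym (strictlyInverseˡ _)) (trans (cong to eq) (strictlyInverseˡ _))

  to-injective : ∀ {x y} → to x ≡ to y → x ≡ y
  to-injective eq = trans (sym (strictlyInverseʳ _)) (trans (cong from eq) (strictlyInverseʳ _))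

  left : ∀ {a b c} → Distinct₃ a b c →
         op relabelled (a , false) (b , false) (c , false) ≡ (to (op q a b c) , true)
  left {a} {b} {c} D rewrite dec-true (distinct? a b c) D = refl

  right : ∀ {a b c} → Distinct₃ a b c →
          op relabelled (a , true) (b , true) (c , true) ≡ (from (op q a b c) , false)
  right {a} {b} {c} (a≢b , a≢c , b≢c)
    rewrite dec-true (distinct? (from a) (from b) (from c))
                     (a≢b ∘ from-injective , a≢c ∘ from-injective , b≢c ∘ from-injective)
          | strictlyInverseˡ a | strictlyInverseˡ b | strictlyInverseˡ c = refl

  across : ∀ {a b} c → ¬ Distinct₃ a b (from c) →
           op relabelled (a , false) (b , false) (c , true) ≡ (to (op q a b (from c)) , true)
  across {a} {b} c ¬D rewrite dec-false (distinct? a b (from c)) ¬D = refl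

  across-distinct : ∀ {a b} c → Distinct₃ a b (from c) →
                    op relabelled (a , false) (b , false) (c , true) ≡ (op q a b (from c) , false)
  across-distinct {a} {b} c D rewrite dec-true (distinct? a b (from c)) D = refl

  -- The pairs of fibres become the blocks `{a, b | to a, to b}`. If `from c` were neither `a` nor
  -- `b`, the triple would be distinct and its fourth point would lie in the first half.
  across⇒pair : ∀ {a b c d} → a ≢ b →
                op relabelled (a , false) (b , false) (c , true) ≡ (d , true) → MapsPair α a b c d
  across⇒pair {a} {b} {c} {d} a≢b eq = by-cases (a ≟ from c) (b ≟ from c)
    where
    to-op≡d : ¬ Distinct₃ a b (from c) → to (op q a b (from c)) ≡ d
    to-op≡d ¬D = cong proj₁ (trans (sym (across c ¬D)) eq)

    by-cases : Dec (a ≡ from c) → Dec (b ≡ from c) → MapsPair α a b c d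
    by-cases (no a≢c) (no b≢c) = case trans (sym (across-distinct c (a≢b , a≢c , b≢c))) eq of λ ()
    by-cases (yes refl) _ = inj₁ (strictlyInverseˡ c ,
      trans (cong to (sym (cancel₁₃ q (from c) b))) (to-op≡d λ (_ , a≢a , _) → a≢a refl))
    by-cases (no _) (yes refl) = inj₂
      (trans (cong to (sym (cancel₂₃ q a (from c)))) (to-op≡d λ (_ , _ , b≢b) → b≢b refl)
      , strictlyInverseˡ c)

  pair⇒across : ∀ {a b c d} → MapsPair α a b c d →
                op relabelled (a , false) (b , false) (c , true) ≡ (d , true)
  pair⇒across {a} {b} (inj₁ (refl , refl)) =
    trans (across (to a) λ (_ , a≢a , _) → a≢a (sym (strictlyInverseʳ a)))
          (cong (λ x → to x , true) (trans (cong (op q a b) (strictlyInverseʳ a)) (cancel₁₃ q a b)))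
  pair⇒across {a} {b} (inj₂ (refl , refl)) =
    trans (across (to b) λ (_ , _ , b≢b) → b≢b (sym (strictlyInverseʳ b)))
          (cong (λ x → to x , true) (trans (cong (op q a b) (strictlyInverseʳ b)) (cancel₂₃ q a b)))

  crossing : Crossing A
  crossing = record { skein = relabelled ; leaves = λ { false D → cong proj₂ (left D) ; true D → cong proj₂ (right D) } }

-- Permutations from the rows of a perpendicular array

bijections : ∀ {m} {rows : Vec (Vec (Fin n) n) m} → All Unique rows → List (Fin n ↔ Fin n)
bijections []       = []
bijections (u ∷ us) = injective⇒↔ _ (lookup-injective u) ∷ bijections us

tally-bijections : ∀ {m} {rows : Vec (Vec (Fin n) n) m} (us : All Unique rows)
  (h : (Fin n ↔ Fin n) → ℕ) {P : Vec (Fin n) n → Set} (P? : ∀ r → Dec (P r)) →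
  (∀ r u → h (injective⇒↔ _ (lookup-injective {xs = r} u)) ≡ ♯ (P? r)) →
  tally h (bijections us) ≡ Vec.count P? rows
tally-bijections []                      h P? eq = refl
tally-bijections {rows = r ∷ _} (u ∷ us) h P? eq
  rewrite eq r u | tally-bijections us h P? eq with does (P? r)
... | true  = refl
... | false = refl

∈-image⁻ : ∀ {ℓ} (f : Fin ℓ → Fin n) S {y} → y ∈ image f S → ∃ λ x → x ∈ S × f x ≡ y
∈-image⁻ f S {y} y∈ with Fin.any? (λ x → (x ∈? S) ×-dec (f x Fin.≟ y))
                        | trans (sym (lookup∘tabulate _ y)) ([]=⇒lookup y∈)
... | yes found | _  = found
... | no  _     | ()

∈-image⁺ : ∀ {ℓ} (f : Fin ℓ → Fin n) S {x} → x ∈ S → f x ∈ image f S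
∈-image⁺ f S {x} x∈ = lookup⇒[]= (f x) _
  (trans (lookup∘tabulate _ (f x)) (dec-true (Fin.any? λ z → (z ∈? S) ×-dec (f z Fin.≟ f x)) (x , x∈ , refl)))

image-pair : (f : Fin n → Fin n) (x y : Fin n) → image f ⟦ x · y ⟧ ≡ ⟦ f x · f y ⟧
image-pair f x y = ⊆-antisym to-pair from-pair
  where
  to-pair : image f ⟦ x · y ⟧ ⊆ ⟦ f x · f y ⟧
  to-pair z∈ with ∈-image⁻ f ⟦ x · y ⟧ z∈
  ... | w , w∈ , refl with ∈₂⇒ w∈
  ...   | inj₁ refl = x∈⁅x⁆∪p
  ...   | inj₂ refl = ∈-skip x∈⁅x⁆∪p

  from-pair : ⟦ f x · f y ⟧ ⊆ image f ⟦ x · y ⟧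
  from-pair z∈ with ∈₂⇒ z∈
  ... | inj₁ refl = ∈-image⁺ f ⟦ x · y ⟧ x∈⁅x⁆∪p
  ... | inj₂ refl = ∈-image⁺ f ⟦ x · y ⟧ (∈-skip x∈⁅x⁆∪p)

⟦⟧≡⇒ : {a b p q : Fin n} → p ≢ q → ⟦ a · b ⟧ ≡ ⟦ p · q ⟧ → (a ≡ p × b ≡ q) ⊎ (a ≡ q × b ≡ p)
⟦⟧≡⇒ {a = a} {b} {p} {q} p≢q eq
  with ∈₂⇒ (subst (p ∈_) (sym eq) x∈⁅x⁆∪p) | ∈₂⇒ (subst (q ∈_) (sym eq) (∈-skip x∈⁅x⁆∪p))
... | inj₁ p≡a | inj₁ q≡a = contradiction (trans p≡a (sym q≡a)) p≢q
... | inj₁ p≡a | inj₂ q≡b = inj₁ (sym p≡a , sym q≡b)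
... | inj₂ p≡b | inj₁ q≡a = inj₂ (sym q≡a , sym p≡b)
... | inj₂ p≡b | inj₂ q≡b = contradiction (trans p≡b (sym q≡b)) p≢q

⟦⟧≡⇐ : {a b p q : Fin n} → (a ≡ p × b ≡ q) ⊎ (a ≡ q × b ≡ p) → ⟦ a · b ⟧ ≡ ⟦ p · q ⟧
⟦⟧≡⇐ (inj₁ (refl , refl)) = refl
⟦⟧≡⇐ (inj₂ (refl , refl)) = ⁅⁆∪-swap _ _ ∅

mapsPair? : (α : Fin n ↔ Fin n) → ∀ x y p q → Dec (MapsPair α x y p q)
mapsPair? α x y p q = ((to x Fin.≟ p) ×-dec (to y Fin.≟ q)) ⊎-dec ((to x Fin.≟ q) ×-dec (to y Fin.≟ p))
  where open Inverse α

module Array {γ n : ℕ} (PA : PerpendicularArray γ 2 n n) where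
  open PerpendicularArray PA

  arrangements : List (Fin n ↔ Fin n)
  arrangements = bijections distinct

  -- A row, read as a permutation from columns to entries, has the entry set `{p, q}` in columns
  -- `x`, `y` exactly when it maps the one pair onto the other.
  pair-count : ∀ {x y p q} → x ≢ y → p ≢ q →
               tally (λ α → ♯ (mapsPair? α x y p q)) arrangements ≡ γ
  pair-count {x} {y} {p} {q} x≢y p≢q = trans
    (tally-bijections distinct _ (λ r → image (Vec.lookup r) ⟦ x · y ⟧ ≟ˢ ⟦ p · q ⟧)
      λ r u → ♯-cong (mapsPair? (injective⇒↔ _ (lookup-injective u)) x y p q) (_ ≟ˢ _)
        (λ pair → trans (image-pair (Vec.lookup r) x y) (⟦⟧≡⇐ pair))
        (λ eq → ⟦⟧≡⇒ p≢q (trans (sym (image-pair (Vec.lookup r) x y)) eq)))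
    (perpendicular ⟦ x · y ⟧ (∣₂∣ x≢y) ⟦ p · q ⟧ (∣₂∣ p≢q))

module ColumnCount {γ m : ℕ} (PA : PerpendicularArray γ 2 (suc m) (suc m)) where
  open Array PA

  column : (x p : Fin (suc m)) → ℕ
  column x p = tally (λ α → ♯ (Inverse.to α x Fin.≟ p)) arrangements

  others-once : ∀ {p v} → v ≢ p → tally (λ j → ♯ (v Fin.≟ punchIn p j)) (allFin m) ≡ 1
  others-once {p} {v} v≢p = trans
    (tally-cong (λ j → ♯-cong (v Fin.≟ punchIn p j) (punchOut (v≢p ∘ sym) Fin.≟ j)
      (λ eq → Fin.punchIn-injective p _ _ (trans (Fin.punchIn-punchOut _) eq))
      (λ { refl → sym (Fin.punchIn-punchOut _) })) (allFin m))
    (allFin-once (punchOut (v≢p ∘ sym)))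

  -- Every row in which p occurs in column x or column y has exactly one further
  -- entry q in these columns.
  two-columns : ∀ {x y} p → x ≢ y → column x p + column y p ≡ m * γ
  two-columns {x} {y} p x≢y = begin
    column x p + column y p
      ≡⟨ tally-+ _ _ arrangements ⟨
    tally (λ α → ♯ (Inverse.to α x Fin.≟ p) + ♯ (Inverse.to α y Fin.≟ p)) arrangements
      ≡⟨ tally-cong (λ α → sym (row α)) arrangements ⟩
    tally (λ α → tally (λ j → ♯ (mapsPair? α x y p (punchIn p j))) (allFin m)) arrangements
      ≡⟨ tally-swap (λ α j → ♯ (mapsPair? α x y p (punchIn p j))) arrangements (allFin m) ⟩
    tally (λ j → tally (λ α → ♯ (mapsPair? α x y p (punchIn p j))) arrangements) (allFin m)
      ≡⟨ tally-cong (λ j → pair-count x≢y (Fin.punchInᵢ≢i p j ∘ sym)) (allFin m) ⟩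
    tally (λ _ → γ) (allFin m)
      ≡⟨ tally-const γ (allFin m) ⟩
    length (allFin m) * γ
      ≡⟨ cong (_* γ) (length-tabulate {n = m} (λ i → i)) ⟩
    m * γ ∎
    where
    open ≡-Reasoning

    row : ∀ α → tally (λ j → ♯ (mapsPair? α x y p (punchIn p j))) (allFin m)
                ≡ ♯ (Inverse.to α x Fin.≟ p) + ♯ (Inverse.to α y Fin.≟ p)
    row α = by-cases (to x Fin.≟ p) (to y Fin.≟ p)
      where
      open Inverse α

      to≢ : to x ≢ to y
      to≢ eq = x≢y (trans (sym (strictlyInverseʳ x)) (trans (cong from eq) (strictlyInverseʳ y)))

      by-cases : (x? : Dec (to x ≡ p)) (y? : Dec (to y ≡ p)) →
                 tally (λ j → ♯ (mapsPair? α x y p (punchIn p j))) (allFin m) ≡ ♯ x? + ♯ y?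
      by-cases (yes x≡p) (yes y≡p) = contradiction (trans x≡p (sym y≡p)) to≢
      by-cases (yes x≡p) (no y≢p) = trans
        (tally-cong (λ j → ♯-cong (mapsPair? α x y p (punchIn p j)) (to y Fin.≟ punchIn p j)
          (λ { (inj₁ (_ , eq)) → eq ; (inj₂ (_ , y≡p)) → contradiction y≡p y≢p })
          (λ eq → inj₁ (x≡p , eq))) (allFin m))
        (others-once y≢p)
      by-cases (no x≢p) (yes y≡p) = trans
        (tally-cong (λ j → ♯-cong (mapsPair? α x y p (punchIn p j)) (to x Fin.≟ punchIn p j)
          (λ { (inj₁ (x≡p , _)) → contradiction x≡p x≢p ; (inj₂ (eq , _)) → eq })
          (λ eq → inj₂ (eq , y≡p))) (allFin m))
        (others-once x≢p)
      by-cases (no x≢p) (no y≢p) = tally-zero (λ j → ♯-no (mapsPair? α x y p (punchIn p j)) λ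
        { (inj₁ (x≡p , _)) → x≢p x≡p ; (inj₂ (_ , y≡p)) → y≢p y≡p }) (allFin m)

  -- Any two of the three columns have the same total by `two-columns`, so all three counts are
  -- equal, each being half of `m * γ`.
  column-count : ∀ {μ} → 2 * μ ≡ m * γ → ∀ {x y z} → x ≢ y → x ≢ z → y ≢ z → ∀ p → column x p ≡ μ
  column-count {μ} 2μ≡ {x} {y} {z} x≢y x≢z y≢z p =
    ℕ.+-cancelʳ-≡ μ (column x p) μ (begin
      column x p + μ          ≡⟨ cong (column x p +_) y≡μ ⟨
      column x p + column y p ≡⟨ two-columns p x≢y ⟩
      m * γ                   ≡⟨ 2μ≡ ⟨
      2 * μ                   ≡⟨ cong (μ +_) (ℕ.+-identityʳ μ) ⟩
      μ + μ                   ∎)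
    where
    open ≡-Reasoning

    y≡z : column y p ≡ column z p
    y≡z = ℕ.+-cancelˡ-≡ (column x p) _ _ (trans (two-columns p x≢y) (sym (two-columns p x≢z)))

    y≡μ : column y p ≡ μ
    y≡μ = ℕ.*-cancelˡ-≡ (column y p) μ 2 (begin
      2 * column y p          ≡⟨ cong (column y p +_) (ℕ.+-identityʳ _) ⟩
      column y p + column y p ≡⟨ cong (column y p +_) y≡z ⟩
      column y p + column z p ≡⟨ two-columns p y≢z ⟩
      m * γ                   ≡⟨ 2μ≡ ⟨
      2 * μ                   ∎)

length-filter : ∀ {a} {A : Set a} {P : A → Set} (P? : ∀ x → Dec (P x)) → ∀ xs → length (filter P? xs) ≡ tally (♯ ∘ P?) xs
length-filter P? []       = refl
length-filter P? (x ∷ xs) with does (P? x)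
... | true  = cong suc (length-filter P? xs)
... | false = length-filter P? xs

module Base {k γ μ : ℕ} .{{_ : NonZero γ}} (2μ≡ : 2 * μ ≡ (3 + k) * γ)
            (LS : LargeSet 3 4 (4 + k) μ) (PA : PerpendicularArray γ 2 (4 + k) (4 + k)) where
  open Array PA
  open ColumnCount PA using (column-count)
  open LargeSet LS using (multiplicity) renaming (systems to steinerSystems)

  N = 4 + k

  skeins : List (Skein (Fin N))
  skeins = map ToSkein.toSkein steinerSystems

  skeins-count : ∀ {a b c d} → Distinct₄ a b c d → tally (λ S → ♯ (op S a b c Fin.≟ d)) skeins ≡ μ
  skeins-count {a} {b} {c} {d} D = begin
    tally (λ S → ♯ (op S a b c Fin.≟ d)) skeins
      ≡⟨ tally-map _ ToSkein.toSkein steinerSystems ⟩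
    tally (λ S → ♯ (op (ToSkein.toSkein S) a b c Fin.≟ d)) steinerSystems
      ≡⟨ tally-cong (λ S → ♯-cong (_ Fin.≟ d) (block? S ⟦ a · b · c · d ⟧)
           (ToSkein.op⇒block S D) (ToSkein.block⇒op S D)) steinerSystems ⟩
    tally (λ S → ♯ (block? S ⟦ a · b · c · d ⟧)) steinerSystems
      ≡⟨ length-filter (λ S → block? S ⟦ a · b · c · d ⟧) steinerSystems ⟨
    length (filter (λ S → block? S ⟦ a · b · c · d ⟧) steinerSystems)
      ≡⟨ multiplicity ⟦ a · b · c · d ⟧ (∣₄∣ D) ⟩
    μ ∎
    where open ≡-Reasoning

  -- The factor `3 + k` is at least 2. The bound makes `μ ∸ γ` a true difference.
  γ≤μ : γ ≤ μ
  γ≤μ = ℕ.*-cancelˡ-≤ 2 (ℕ.≤-trans (ℕ.*-monoˡ-≤ γ {2} {3 + k} (s≤s (s≤s z≤n))) (ℕ.≤-reflexive (sym 2μ≡)))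

  μ≢0 : μ ≢ 0
  μ≢0 refl = ℕ.<⇒≱ (>-nonZero⁻¹ γ) γ≤μ

  p₀ p₁ p₂ p₃ : Fin N
  p₀ = zero
  p₁ = suc zero
  p₂ = suc (suc zero)
  p₃ = suc (suc (suc zero))

  -- The points `p₀` to `p₃` form a block of `μ` systems and `μ` is not zero, so the list has a
  -- first member; any member would serve.
  q : Skein (Fin N)
  q = some skeins (skeins-count {p₀} {p₁} {p₂} {p₃}
        (((λ ()) , (λ ()) , λ ()) , (λ ()) , (λ ()) , λ ()))
    where
    some : {h : Skein (Fin N) → ℕ} → ∀ xs → tally h xs ≡ μ → Skein (Fin N)
    some []      eq = contradiction (sym eq) μ≢0
    some (S ∷ _) eq = S

  -- This is the Steiner loop of the triple system derived at the point `zero`. It is totally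
  -- symmetric with identity `zero`, so colour and partner have the same formula.
  qColouring : Colouring (Fin N) zero
  qColouring = record
    { colour         = λ a b → op q a b zero
    ; partner        = λ a k → op q a k zero
    ; colour-comm    = λ a b → comm₁₂ q a b zero
    ; colour-diag    = λ a → cancel q a zero
    ; colour-partner = λ a k → twice-op a k
    ; partner-colour = λ a b → twice-op a b
    }
    where
    twice-op : ∀ a b → op q a (op q a b zero) zero ≡ b
    twice-op a b = trans (comm₂₃ q a _ zero)
      (trans (cong (op q a zero) (comm₂₃ q a b zero)) (invol q a zero b))

  column-μ : ∀ x p → tally (λ α → ♯ (Inverse.to α x Fin.≟ p)) arrangements ≡ μ
  -- Two further columns are needed beside `x`; they are the first two that differ from it.
  column-μ x = column-count 2μ≡ {x} {punchIn x zero} {punchIn x (suc zero)}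
    (Fin.punchInᵢ≢i x zero ∘ sym) (Fin.punchInᵢ≢i x (suc zero) ∘ sym)
    (λ eq → case Fin.punchIn-injective x zero (suc zero) eq of λ ())

  rest : List (Fin N)
  rest = tabulate (λ i → suc (suc (suc i)))

  rest-length : length rest ≡ 1 + k
  rest-length = length-tabulate {n = 1 + k} (λ i → suc (suc (suc i)))

  crossings : List (Crossing (Fin N))
  crossings = map (Relabelled.crossing Fin._≟_ q) arrangements

  rotations : List (Recolouring (Fin N) zero)
  rotations = copies (μ ∸ γ) (map rotating (allFin (3 + k)))

  tally-μ : (h : Fin N → ℕ) → (∀ p → h p ≡ μ) → ∀ ps → tally h ps ≡ μ * length ps
  tally-μ h h≡μ ps = trans (tally-cong h≡μ ps) (trans (tally-const μ ps) (ℕ.*-comm (length ps) μ))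

  -- The rows are sorted by their entry in column `p₀`, each of the `N` entries occurring `μ` times.
  crossings-length : length crossings ≡ μ * length (allFin N)
  crossings-length = begin
    length crossings    ≡⟨ length-map _ arrangements ⟩
    length arrangements ≡⟨ length-by-value Fin._≟_ (λ α → Inverse.to α p₀) (allFin N) allFin-once arrangements ⟩
    tally (λ p → tally (λ α → ♯ (Inverse.to α p₀ Fin.≟ p)) arrangements) (allFin N)
                        ≡⟨ tally-μ _ (column-μ p₀) (allFin N) ⟩
    μ * length (allFin N) ∎
    where open ≡-Reasoning

  -- The systems are sorted by the fourth point of the block through `p₀`, `p₁`, `p₂`. It is none of
  -- these three, and each of the other points occurs `μ` times.
  skeins-length : length skeins ≡ μ * length rest
  skeins-length = begin
    length skeins
      ≡⟨ length-by-value Fin._≟_ (λ S → op S p₀ p₁ p₂) (allFin N) allFin-once skeins ⟩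
    h p₀ + (h p₁ + (h p₂ + tally h rest))
      ≡⟨ cong₂ _+_ (none (λ S → op≢₁ S p₀≢p₁ p₀≢p₂ p₁≢p₂)) (cong₂ _+_ (none (λ S → op≢₂ S p₀≢p₁ p₀≢p₂ p₁≢p₂))
           (cong (_+ tally h rest) (none (λ S → op≢₃ S p₀≢p₁ p₀≢p₂ p₁≢p₂)))) ⟩
    tally h rest
      ≡⟨ tally-tabulate {n = 1 + k} h (λ i → suc (suc (suc i))) ⟩
    tally (λ i → h (suc (suc (suc i)))) (allFin (1 + k))
      ≡⟨ tally-cong (λ i → skeins-count ((p₀≢p₁ , p₀≢p₂ , p₁≢p₂) , (λ ()) , (λ ()) , λ ())) (allFin (1 + k)) ⟩
    tally (λ _ → μ) (allFin (1 + k))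
      ≡⟨ tally-const μ (allFin (1 + k)) ⟩
    length (allFin (1 + k)) * μ
      ≡⟨ ℕ.*-comm _ μ ⟩
    μ * length (allFin (1 + k))
      ≡⟨ cong (μ *_) (trans (length-tabulate {n = 1 + k} (λ i → i)) (sym rest-length)) ⟩
    μ * length rest ∎
    where
    open ≡-Reasoning
    h : Fin N → ℕ
    h d = tally (λ S → ♯ (op S p₀ p₁ p₂ Fin.≟ d)) skeins

    p₀≢p₁ : p₀ ≢ p₁
    p₀≢p₁ ()
    p₀≢p₂ : p₀ ≢ p₂
    p₀≢p₂ ()
    p₁≢p₂ : p₁ ≢ p₂
    p₁≢p₂ ()

    none : ∀ {d} → (∀ S → op S p₀ p₁ p₂ ≢ d) → h d ≡ 0
    none ≢d = tally-zero (λ S → ♯-no (_ Fin.≟ _) (≢d S)) skeins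

  -- Since `γ(N - 1) = 2μ`, the number `(μ - γ)(N - 1)` equals `μ(N - 1) - 2μ = μ(N - 3)`.
  rotations-length : length rotations ≡ μ * length rest
  rotations-length = begin
    length rotations
      ≡⟨ length-copies (μ ∸ γ) (map rotating (allFin (3 + k))) ⟩
    (μ ∸ γ) * length (map rotating (allFin (3 + k)))
      ≡⟨ cong ((μ ∸ γ) *_) (trans (length-map rotating (allFin (3 + k))) (length-tabulate {n = 3 + k} (λ i → i))) ⟩
    (μ ∸ γ) * (3 + k)
      ≡⟨ ℕ.*-distribʳ-∸ (3 + k) μ γ ⟩
    μ * (3 + k) ∸ γ * (3 + k)
      ≡⟨ cong (μ * (3 + k) ∸_) (trans (ℕ.*-comm γ (3 + k)) (trans (sym 2μ≡) (ℕ.*-comm 2 μ))) ⟩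
    μ * (3 + k) ∸ μ * 2
      ≡⟨ ℕ.*-distribˡ-∸ μ (3 + k) 2 ⟨
    μ * (1 + k)
      ≡⟨ cong (μ *_) rest-length ⟨
    μ * length rest ∎
    where open ≡-Reasoning

  rotations-tally : ∀ {i j} → i ≢ zero → j ≢ zero → tally (λ P → ♯ (act P false i Fin.≟ j)) rotations ≡ μ ∸ γ
  rotations-tally {i} {j} i≢0 j≢0 = trans (tally-copies _ (μ ∸ γ) (map rotating (allFin (3 + k))))
    (trans (cong ((μ ∸ γ) *_) (trans (tally-map (λ P → ♯ (act P false i Fin.≟ j)) rotating (allFin (3 + k))) (rotations-count i≢0 j≢0)))
           (ℕ.*-identityʳ (μ ∸ γ)))

  _≟₂_ = Points._≟_ (twice (cyclic (3 + k)))

  -- In the first half the rows sought have the entry `d` in column `op q a b c`. In the second half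
  -- the inverse permutation is applied, so column and entry change places.
  crossings-count : ∀ i {a b c} → Distinct₃ a b c → ∀ d →
    tally (λ E → ♯ (op (skein E) (a , i) (b , i) (c , i) ≟₂ (d , not i))) crossings ≡ μ
  crossings-count false {a} {b} {c} D d = begin
    tally (λ E → ♯ (op (skein E) (a , false) (b , false) (c , false) ≟₂ (d , true))) crossings
      ≡⟨ tally-map _ _ arrangements ⟩
    tally (λ α → ♯ (op (Relabelled.relabelled Fin._≟_ q α) (a , false) (b , false) (c , false) ≟₂ (d , true))) arrangements
      ≡⟨ tally-cong (λ α → ♯-cong (_ ≟₂ _) (Inverse.to α (op q a b c) Fin.≟ d)
           (λ eq → cong proj₁ (trans (sym (Relabelled.left Fin._≟_ q α D)) eq))
           (λ eq → trans (Relabelled.left Fin._≟_ q α D) (cong (_, true) eq))) arrangements ⟩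
    tally (λ α → ♯ (Inverse.to α (op q a b c) Fin.≟ d)) arrangements
      ≡⟨ column-μ (op q a b c) d ⟩
    μ ∎
    where open ≡-Reasoning
  crossings-count true {a} {b} {c} D d = begin
    tally (λ E → ♯ (op (skein E) (a , true) (b , true) (c , true) ≟₂ (d , false))) crossings
      ≡⟨ tally-map _ _ arrangements ⟩
    tally (λ α → ♯ (op (Relabelled.relabelled Fin._≟_ q α) (a , true) (b , true) (c , true) ≟₂ (d , false))) arrangements
      ≡⟨ tally-cong (λ α → ♯-cong (_ ≟₂ _) (Inverse.to α d Fin.≟ op q a b c)
           (λ eq → trans (cong (Inverse.to α) (sym (cong proj₁ (trans (sym (Relabelled.right Fin._≟_ q α D)) eq))))
                         (Inverse.strictlyInverseˡ α _))
           (λ eq → trans (Relabelled.right Fin._≟_ q α D)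
                         (cong (_, false) (trans (cong (Inverse.from α) (sym eq)) (Inverse.strictlyInverseʳ α d)))))
           arrangements ⟩
    tally (λ α → ♯ (Inverse.to α d Fin.≟ op q a b c)) arrangements
      ≡⟨ column-μ d (op q a b c) ⟩
    μ ∎
    where open ≡-Reasoning

  base : Stage μ (cyclic (3 + k))
  base = record
    { colouring    = qColouring
    ; e₀           = p₀
    ; e₁           = p₁
    ; e₂           = p₂
    ; rest         = rest
    ; enum-once    = allFin-once
    ; pure         = skeins
    ; perms        = rotations
    ; cross        = crossings
    ; pure-length  = skeins-length
    ; perms-length = rotations-length
    ; cross-length = crossings-length
    ; pure-count   = skeins-count
    ; cross-count  = crossings-count
    -- The rows taking `a`, `b` to `c`, `d` give `γ`, and the rotations give the remaining `μ ∸ γ`.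
    ; mixed-count  = λ {a} {b} {c} {d} a≢b c≢d → trans
        (cong₂ _+_
          (trans (tally-map _ _ arrangements)
            (trans (tally-cong (λ α → ♯-cong (_ ≟₂ _) (mapsPair? α a b c d)
                     (Relabelled.across⇒pair Fin._≟_ q α a≢b) (Relabelled.pair⇒across Fin._≟_ q α)) arrangements)
                   (pair-count a≢b c≢d)))
          (rotations-tally (colour≢ε qColouring a≢b) (colour≢ε qColouring c≢d)))
        (ℕ.m+[n∸m]≡n γ≤μ)
    }

-- Iterated doubling and the resulting large sets

stage⇒largeSet : ∀ {μ N G} → Stage μ G → Fin N ↔ Points.Carrier G → 4 ≤ N → LargeSet 3 4 N μ
stage⇒largeSet {μ} {N} {G} St i 4≤N = record
  { k≤n          = 4≤N
  ; systems      = map toSystem pure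
  ; multiplicity = count
  }
  where
  open Stage St
  open Points G
  open Inverse i

  toSystem : Skein Carrier → SteinerSystem 3 4 N
  toSystem S = FromSkein.steinerSystem (transport i S)

  to-injective : ∀ {x y} → to x ≡ to y → x ≡ y
  to-injective eq = trans (sym (strictlyInverseʳ _)) (trans (cong from eq) (strictlyInverseʳ _))

  count : ∀ K → ∣ K ∣ ≡ 4 → length (filter (λ S → block? S K) (map toSystem pure)) ≡ μ
  count K ∣K∣≡4 with ∣∣≡4⇒ K ∣K∣≡4
  ... | a , b , c , d , D@((ab , ac , bc) , ad , bd , cd) , refl = begin
    length (filter (λ S → block? S ⟦ a · b · c · d ⟧) (map toSystem pure))
      ≡⟨ length-filter (λ S → block? S ⟦ a · b · c · d ⟧) (map toSystem pure) ⟩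
    tally (λ S → ♯ (block? S ⟦ a · b · c · d ⟧)) (map toSystem pure)
      ≡⟨ tally-map _ toSystem pure ⟩
    tally (λ S → ♯ (block? (toSystem S) ⟦ a · b · c · d ⟧)) pure
      ≡⟨ tally-cong (λ S → ♯-cong (block? (toSystem S) ⟦ a · b · c · d ⟧) (op S (to a) (to b) (to c) ≟ to d)
           (λ B → trans (sym (strictlyInverseˡ _))
                        (cong to (FromSkein.isBlock⇒op (transport i S) D B)))
           (λ eq → FromSkein.op⇒isBlock (transport i S) D (trans (cong from eq) (strictlyInverseʳ d)))) pure ⟩
    tally (λ S → ♯ (op S (to a) (to b) (to c) ≟ to d)) pure
      ≡⟨ pure-count ((ab ∘ to-injective , ac ∘ to-injective , bc ∘ to-injective)
                    , ad ∘ to-injective , bd ∘ to-injective , cd ∘ to-injective) ⟩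
    μ ∎
    where open ≡-Reasoning

tower : Points → ℕ → Points
tower G zero    = G
tower G (suc m) = twice (tower G m)

climb : ∀ {μ G} → Stage μ G → ∀ m → Stage μ (tower G m)
climb St zero    = St
climb St (suc m) = NextStage.next (climb St m)

tower-size : ∀ {G n} → Fin n ↔ Points.Carrier G → ∀ m → Fin (2 ^ m * n) ↔ Points.Carrier (tower G m)
tower-size {G} {n} i zero    = subst (λ k → Fin k ↔ Points.Carrier G) (sym (ℕ.*-identityˡ n)) i
tower-size {G} {n} i (suc m) =
  subst (λ k → Fin k ↔ Points.Carrier (tower G (suc m)))
        (trans (ℕ.*-comm (2 ^ m * n) 2) (sym (ℕ.*-assoc 2 (2 ^ m) n)))
        (↔-trans Fin.*↔× (tower-size i m ×-↔ Fin.2↔Bool))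

theorem30 : ∀ (n γ μ : ℕ) .{{_ : NonZero n}} .{{_ : NonZero γ}} →
    2 * μ ≡ (n ∸ 1) * γ →
    LargeSet 3 4 n μ →
    PerpendicularArray γ 2 n n →
    ∀ (m : ℕ) → LargeSet 3 4 (2 ^ m * n) μ
theorem30 n γ μ 2μ≡ LS PA m with LargeSet.k≤n LS
-- Matching on `4 ≤ n` exhibits `n` as `4 + k`, the form in which `Base` takes the number of points.
... | s≤s (s≤s (s≤s (s≤s z≤n))) =
  stage⇒largeSet (climb (Base.base 2μ≡ LS PA) m) (tower-size ↔-refl m)
    (ℕ.≤-trans (LargeSet.k≤n LS) (ℕ.m≤n*m n (2 ^ m) {{ℕ.m^n≢0 2 m}}))
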